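{- The problem \textsc{Token Sliding} is solvable in polynomial time on oriented cycles, i.e. there is a polynomial-time algorithm which, given an instance $(G,S,T)$ in which $G$ is an oriented cycle, decides whether it is a yes-instance.
   Context: An oriented graph is a finite directed graph without loops in which no pair of vertices has directed edges (arcs) in both directions. The underlying undirected graph of an oriented graph $G$, denoted $G^{\mathrm{und}}$, is obtained by removing all edge directions. A set of vertices of $G$ is independent if it is independent in $G^{\mathrm{und}}$. An oriented cycle is an oriented graph whose underlying undirected graph is a cycle (the arcs may be oriented arbitrarily). \textsc{Token Sliding} (on oriented graphs): an instance $(G,S,T)$ consists of an oriented graph $G$ and two independent sets $S,T$ of $G$. The question is whether there is a sequence $\langle S=I_0,I_1,\dots,I_\ell=T\rangle$ such that each $I_i$ ($0\le i\le \ell$) is an independent set of $G$ and, for each $0\le i\le \ell-1$, there is an arc $(u,v)$ of $G$ with $I_i\setminus I_{i+1}=\{u\}$ and $I_{i+1}\setminus I_i=\{v\}$ (a token slides from $u$ to the unoccupied out-neighbour $v$). The instance is a yes-instance if such a sequence exists. -}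

module Defs where

open import Data.Bool.Base using (Bool; true; false; T)
open import Data.Fin.Base using (Fin; zero; suc; toℕ; fromℕ; inject₁)
open import Data.Fin.Permutation using (Permutation′; _⟨$⟩ʳ_)
open import Data.Fin.Subset using (Subset; _∈_; _─_; ⁅_⁆)
open import Data.List.Base using (List; foldr)
open import Data.Nat.Base using (ℕ; zero; suc; _+_; _*_; _^_; _≤_)
open import Data.Product.Base using (Σ-syntax; ∃-syntax; _×_; _,_)
open import Data.Sum.Base using (_⊎_)
open import Data.Vec.Base using (Vec; lookup; map; replicate; toList; tabulate; _∷_; _[_]≔_)
open import Function.Bundles using (_⇔_)
open import Relation.Binary.PropositionalEquality using (_≡_)
open import Relation.Nullary using (¬_)

record OrientedGraph : Set where
  field
    order     : ℕ
    arc       : Fin order → Fin order → Bool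

  Arc : Fin order → Fin order → Set
  Arc u v = T (arc u v)

  field
    loopless  : ∀ u → ¬ Arc u u
    oneWay    : ∀ u v → Arc u v → ¬ Arc v u

open OrientedGraph public

-- The edge relation of the underlying undirected graph.
Und : (G : OrientedGraph) → Fin (order G) → Fin (order G) → Set
Und G u v = Arc G u v ⊎ Arc G v u

Independent : (G : OrientedGraph) → Subset (order G) → Set
Independent G I = ∀ u v → u ∈ I → v ∈ I → ¬ Und G u v

-- j comes right after i in the cyclic order 0, 1, …, n-1, 0.
CyclicSucc : ∀ {n} → Fin n → Fin n → Set
CyclicSucc {n} i j = suc (toℕ i) ≡ toℕ j ⊎ (suc (toℕ i) ≡ n × toℕ j ≡ 0)

IsCycle : ∀ {n} → (Fin n → Fin n → Set) → Set
IsCycle {n} E =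
  3 ≤ n ×
  (Σ[ π ∈ Permutation′ n ] ∀ i j →
    E (π ⟨$⟩ʳ i) (π ⟨$⟩ʳ j) ⇔ (CyclicSucc i j ⊎ CyclicSucc j i))

IsOrientedCycle : OrientedGraph → Set
IsOrientedCycle G = IsCycle (Und G)

Slide : (G : OrientedGraph) → Subset (order G) → Subset (order G) → Set
Slide G I J = ∃[ u ] ∃[ v ] (Arc G u v × I ─ J ≡ ⁅ u ⁆ × J ─ I ≡ ⁅ v ⁆)

record Instance : Set where
  field
    graph       : OrientedGraph
    source      : Subset (order graph)
    target      : Subset (order graph)
    sourceIndep : Independent graph source
    targetIndep : Independent graph target

open Instance public

YesInstance : Instance → Set
YesInstance x =
  Σ[ ℓ ∈ ℕ ] Σ[ I ∈ (Fin (suc ℓ) → Subset (order G)) ]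
    (I zero ≡ source x
    × I (fromℕ ℓ) ≡ target x
    × (∀ i → Independent G (I i))
    × (∀ (i : Fin ℓ) → Slide G (I (inject₁ i)) (I (suc i))))
  where G = graph x

-- The machine model is Jones's WHILE language over binary trees
-- ("Computability and Complexity: From a Programming Perspective", 1997)
-- with his unit-cost time measure.  Trees can be shared and the only test is
-- comparison with nil, so polynomial time in this model is polynomial time
-- on Turing machines.

infixr 6 _∙_

data Tree : Set where
  nil : Tree
  _∙_ : Tree → Tree → Tree

size : Tree → ℕ
size nil     = 1
size (a ∙ b) = suc (size a + size b)

head : Tree → Tree
head nil     = nil
head (a ∙ _) = a

tail : Tree → Tree
tail nil     = nil
tail (_ ∙ b) = b

data Expr (k : ℕ) : Set where
  var  : Fin k → Expr k
  nil  : Expr k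
  cons : Expr k → Expr k → Expr k
  hd   : Expr k → Expr k
  tl   : Expr k → Expr k

infixr 4 _⨾_
infix  5 _≔_

data Cmd (k : ℕ) : Set where
  _≔_           : Fin k → Expr k → Cmd k
  _⨾_           : Cmd k → Cmd k → Cmd k
  if_then_else_ : Expr k → Cmd k → Cmd k → Cmd k
  while_loop_   : Expr k → Cmd k → Cmd k

Store : ℕ → Set
Store k = Vec Tree k

eval : ∀ {k} → Expr k → Store k → Tree
eval (var x)    σ = lookup σ x
eval nil        σ = nil
eval (cons e f) σ = eval e σ ∙ eval f σ
eval (hd e)     σ = head (eval e σ)
eval (tl e)     σ = tail (eval e σ)

cost : ∀ {k} → Expr k → ℕ
cost (var x)    = 1
cost nil        = 1
cost (cons e f) = suc (cost e + cost f)
cost (hd e)     = suc (cost e)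
cost (tl e)     = suc (cost e)

private
  variable
    k s t    : ℕ
    σ σ′ σ″ : Store k
    e        : Expr k
    c d      : Cmd k
    a b      : Tree

infix 3 ⟨_,_⟩⇓[_]_

-- ⟨ c , σ ⟩⇓[ t ] σ′: started in store σ, the command c halts in store σ′
-- after t units of time.  Any tree other than nil counts as true.
data ⟨_,_⟩⇓[_]_ {k : ℕ} : Cmd k → Store k → ℕ → Store k → Set where
  assign    : ∀ {x} → ⟨ x ≔ e , σ ⟩⇓[ suc (cost e) ] (σ [ x ]≔ eval e σ)
  seq       : ⟨ c , σ ⟩⇓[ s ] σ′ → ⟨ d , σ′ ⟩⇓[ t ] σ″ →
              ⟨ c ⨾ d , σ ⟩⇓[ suc (s + t) ] σ″
  ifTrue    : eval e σ ≡ a ∙ b → ⟨ c , σ ⟩⇓[ t ] σ′ →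
              ⟨ if e then c else d , σ ⟩⇓[ suc (cost e + t) ] σ′
  ifFalse   : eval e σ ≡ nil → ⟨ d , σ ⟩⇓[ t ] σ′ →
              ⟨ if e then c else d , σ ⟩⇓[ suc (cost e + t) ] σ′
  whileTrue : eval e σ ≡ a ∙ b → ⟨ c , σ ⟩⇓[ s ] σ′ →
              ⟨ while e loop c , σ′ ⟩⇓[ t ] σ″ →
              ⟨ while e loop c , σ ⟩⇓[ suc (cost e + s + t) ] σ″
  whileStop : eval e σ ≡ nil →
              ⟨ while e loop c , σ ⟩⇓[ suc (cost e) ] σ

-- Variable zero holds the input at the start and the output at the end; all
-- other variables are initially nil.
record Program : Set where
  field
    auxVars : ℕ
    body    : Cmd (suc auxVars)

open Program public

_on_returns_within_ : Program → Tree → Tree → ℕ → Set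
P on x returns y within m =
  ∃[ t ] ∃[ ρ ] (⟨ body P , x ∷ replicate (auxVars P) nil ⟩⇓[ t ] (y ∷ ρ) × t ≤ m)

encodeBool : Bool → Tree
encodeBool false = nil
encodeBool true  = nil ∙ nil

encodeList : List Tree → Tree
encodeList = foldr _∙_ nil

encodeVec : ∀ {A : Set} {n} → (A → Tree) → Vec A n → Tree
encodeVec f v = encodeList (toList (map f v))

-- Adjacency matrix, row by row.
encodeGraph : OrientedGraph → Tree
encodeGraph G =
  encodeVec (encodeVec encodeBool) (tabulate (λ u → tabulate (λ v → arc G u v)))

encode : Instance → Tree
encode x =
  encodeGraph (graph x) ∙ encodeVec encodeBool (source x) ∙ encodeVec encodeBool (target x)

-- Polynomial-time decidability of the problem Yes under the promise Dom, for
-- inputs given through the encoding enc.  The bound has to hold only on the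
-- promised inputs.
PolyTimeDecidable : {X : Set} → (X → Tree) → (Dom Yes : X → Set) → Set
PolyTimeDecidable {X} enc Dom Yes =
  Σ[ P ∈ Program ] ∃[ c ] ∃[ k ] ((x : X) → Dom x →
    Σ[ b ∈ Bool ]
      (P on enc x returns encodeBool b within (c * size (enc x) ^ k + c)
      × (T b ⇔ Yes x)))

{-# OPTIONS --safe #-}

-- Recording the net number of tokens that cross each edge of the cycle turns a
-- reconfiguration sequence into an integer flow g whose divergence is the
-- difference of the two token sets and whose sign respects the arcs.
-- Conversely, suppose that such a flow exists and that two consecutive
-- vertices are free.  While the sets differ, some token has positive flow
-- ahead of it; if it is blocked by the token two places ahead, that token has
-- positive flow too, and following the chain to the free pair reaches a token
-- that can slide.  The slide decreases Σ|g| and leaves a free pair behind.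
-- Without a free pair no token can move at all.  On a cycle the divergence
-- determines g up to a constant, which may be taken between -n and n, so the
-- criterion is checked by trying all constants while walking once round the
-- cycle.
--
-- The algorithm is written in a small functional language whose only loops
-- run n times, so that its terms compile to polynomial-time WHILE programs.
module Submission where

open import Data.Bool.Base using (Bool; true; false; not; _∧_; _∨_; _xor_; T)
open import Data.Bool.ListAction using (any)
open import Data.Bool.Properties
  using (¬-not; T-∧; T-∨; ∧-assoc; ∧-comm; ∧-identityʳ; ∨-assoc; ∨-comm; ∨-identityʳ)
  renaming (_≟_ to _≟ᵇ_)
open import Data.Fin.Base using (Fin; zero; suc; toℕ; fromℕ; fromℕ<; inject₁)
open import Data.Fin.Permutation using (_⟨$⟩ʳ_; _⟨$⟩ˡ_; inverseʳ; inverseˡ)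
open import Data.Fin.Properties
  using (any?; fromℕ<-injective; nonZeroIndex; pigeonhole;
         toℕ-fromℕ; toℕ-fromℕ<; toℕ-injective; toℕ-inject₁; toℕ<n)
  renaming (_≟_ to _≟ᶠ_)
open import Data.Fin.Subset using (Subset; _─_; ⁅_⁆; ⊥)
open import Data.Integer.Base as ℤ using (ℤ; +_; -[1+_]; 0ℤ; 1ℤ; ∣_∣)
import Data.Integer.Properties as ℤ
open import Data.Integer.Tactic.RingSolver using (solve-∀)
open import Data.List.Base using (List; []; _∷_; downFrom; length; map)
open import Data.List.Properties using (length-downFrom; length-map)
open import Data.Nat.Base using (ℕ; zero; suc; _+_; _*_; _^_; _∸_; _≤_; _<_; z≤n; s≤s; z<s; NonZero)
open import Data.Nat.DivMod using (_%_; _/_; m≡m%n+[m/n]*n; m%n<n)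
open import Data.Nat.GeneralisedArithmetic using (fold; fold-+; iterate; iterate-is-fold)
open import Data.Nat.Properties
open import Data.Product.Base using (∃; ∃-syntax; Σ-syntax; _×_; _,_; proj₁; proj₂)
open import Data.Sum.Base using (_⊎_; inj₁; inj₂; [_,_]′; swap)
open import Data.Vec.Base using (Vec; []; _∷_; lookup; tabulate; _[_]≔_)
open import Data.Vec.Properties
  using (lookup∘tabulate; lookup∘update; lookup∘update′; lookup⇒[]=; []=⇒lookup; tabulate-cong; tabulate∘lookup)
open import Defs
open import Function.Base using (_∘_)
open import Function.Bundles using (_⇔_; mk⇔; Equivalence)
open import Relation.Binary.Definitions using (tri<; tri≈; tri>)
open import Relation.Binary.PropositionalEquality
  using (_≡_; _≢_; refl; sym; trans; cong; cong₂; subst; subst₂; module ≡-Reasoning)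
open import Relation.Nullary using (¬_; yes; no; does; contradiction; _×-dec_)

-- Cyclic orders

fold-peel : ∀ {A : Set} (x : A) f m → fold x f (suc m) ≡ fold (f x) f m
fold-peel x f m = trans (cong (fold x f) (+-comm 1 m)) (fold-+ x f m)

fold-fixed : ∀ {A : Set} (x : A) f {p} → fold x f p ≡ x → ∀ k → fold x f (k * p) ≡ x
fold-fixed x f     eq zero    = refl
fold-fixed x f {p} eq (suc k) = trans (fold-+ x f p) (trans (cong (λ y → fold y f p) (fold-fixed x f eq k)) eq)

fold-% : ∀ {A : Set} (x : A) f {p} .{{_ : NonZero p}} → fold x f p ≡ x → ∀ m → fold x f (m % p) ≡ fold x f m
fold-% x f {p} eq m = sym (trans (cong (fold x f) (m≡m%n+[m/n]*n m p))
  (trans (fold-+ x f (m % p)) (cong (λ y → fold y f (m % p)) (fold-fixed x f eq (m / p)))))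

-- A chosen direction of travel round the cycle. Both directions satisfy this interface, so an
-- argument made for `next` is reused for `prev` through `mirror`.
record CyclicOrder (G : OrientedGraph) : Set where
  private V = Fin (order G)
  field
    next prev : V → V
    next-prev : ∀ u → next (prev u) ≡ u
    prev-next : ∀ u → prev (next u) ≡ u
    reach     : ∀ u v → ∃[ m ] fold u next m ≡ v
    edge      : ∀ u → Und G u (next u)
    edge⁻¹    : ∀ u v → Und G u v → v ≡ next u ⊎ v ≡ prev u
    3≤order   : 3 ≤ order G

  next-injective : ∀ {u v} → next u ≡ next v → u ≡ v
  next-injective {u} {v} eq = trans (sym (prev-next u)) (trans (cong prev eq) (prev-next v))

  next^-injective : ∀ m {u v} → fold u next m ≡ fold v next m → u ≡ v
  next^-injective zero    eq = eq
  next^-injective (suc m) eq = next^-injective m (next-injective eq)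

  -- If `u` recurs after `p` steps, every vertex is already an iterate with exponent below `p`. With
  -- fewer than `order G` residues, two distinct vertices would share one.
  period-≥ : ∀ u {p} → 0 < p → fold u next p ≡ u → order G ≤ p
  period-≥ u {suc p} 0<p eq = ≮⇒≥ λ p<n →
    let index v = proj₁ (reach u v) % suc p
        i , j , i<j , ij = pigeonhole p<n (λ v → fromℕ< (m%n<n (proj₁ (reach u v)) (suc p)))
        back v = trans (fold-% u next eq (proj₁ (reach u v))) (proj₂ (reach u v))
        same = fromℕ<-injective (index i) (index j)
                 (m%n<n (proj₁ (reach u i)) (suc p)) (m%n<n (proj₁ (reach u j)) (suc p)) ij
    in  <⇒≢ i<j (cong toℕ (trans (sym (back i)) (trans (cong (fold u next) same) (back j))))

  recurrence : ∀ u {i j} → i < j → fold u next i ≡ fold u next j → fold u next (j ∸ i) ≡ u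
  recurrence u {i} {j} i<j eq = next^-injective i (trans (sym (fold-+ u next i))
    (trans (cong (fold u next) (m+[n∸m]≡n (<⇒≤ i<j))) (sym eq)))

  -- Two of the first `order G + 1` iterates coincide. Their distance is a period, at most `order G`
  -- by its range and at least `order G` by `period-≥`.
  period : ∀ u → fold u next (order G) ≡ u
  period u with i , j , i<j , eq ← pigeonhole (n<1+n (order G)) (λ i → fold u next (toℕ i)) =
    subst (λ m → fold u next m ≡ u)
      (≤-antisym (≤-trans (m∸n≤m (toℕ j) (toℕ i)) (≤-pred (toℕ<n j))) (period-≥ u (m<n⇒0<n∸m i<j) rec)) rec
    where rec = recurrence u i<j eq

  next^-unique : ∀ u {i j} → i < order G → j < order G → fold u next i ≡ fold u next j → i ≡ j
  next^-unique u {i} {j} i<n j<n eq with <-cmp i j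
  ... | tri≈ _ i≡j _ = i≡j
  ... | tri< i<j _ _ = contradiction
    (period-≥ u (m<n⇒0<n∸m i<j) (recurrence u i<j eq)) (<⇒≱ (≤-<-trans (m∸n≤m j i) j<n))
  ... | tri> _ _ j<i = contradiction
    (period-≥ u (m<n⇒0<n∸m j<i) (recurrence u j<i (sym eq))) (<⇒≱ (≤-<-trans (m∸n≤m i j) i<n))

  position : ∀ u v → ∃[ m ] (m < order G × fold u next m ≡ v)
  position u v = m % order G , m%n<n m (order G) , trans (fold-% u next (period u) m) (proj₂ (reach u v))
    where
    m = proj₁ (reach u v)
    instance _ = nonZeroIndex u

  next²≢id : ∀ u → next (next u) ≢ u
  next²≢id u eq = contradiction (period-≥ u {2} z<s eq) (<⇒≱ 3≤order)

mirror : ∀ {G} → CyclicOrder G → CyclicOrder G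
mirror {G} K = record
  { next      = prev
  ; prev      = next
  ; next-prev = prev-next
  ; prev-next = next-prev
  ; reach     = λ u v → let m , eq = reach v u in m , trans (cong (λ x → fold x prev m) (sym eq)) (undo v m)
  ; edge      = λ u → subst (λ v → Und G v (prev u)) (next-prev u) (swap (edge (prev u)))
  ; edge⁻¹    = λ u v e → swap (edge⁻¹ u v e)
  ; 3≤order   = 3≤order
  }
  where
  open CyclicOrder K
  undo : ∀ u m → fold (fold u next m) prev m ≡ u
  undo u zero    = refl
  undo u (suc m) = trans (fold-peel _ prev m) (trans (cong (λ x → fold x prev m) (prev-next _)) (undo u m))

-- Flows and slides

+-transfer-≤ : ∀ {i j k l} → i ℤ.+ k ≡ j ℤ.+ l → l ℤ.≤ k → i ℤ.≤ j
+-transfer-≤ {i} {j} {k} {l} eq l≤k = ℤ.i-j≤0⇒i≤j (subst (ℤ._≤ 0ℤ) (sym diff) (ℤ.i≤j⇒i-j≤0 l≤k))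
  where
  lhs : ∀ i j k → i ℤ.- j ≡ i ℤ.+ k ℤ.- (j ℤ.+ k)
  lhs = solve-∀
  rhs : ∀ j k l → j ℤ.+ l ℤ.- (j ℤ.+ k) ≡ l ℤ.- k
  rhs = solve-∀
  diff : i ℤ.- j ≡ l ℤ.- k
  diff = trans (lhs i j k) (trans (cong (ℤ._- (j ℤ.+ k)) eq) (rhs j k l))

∑ : ∀ {n} → (Fin n → ℕ) → ℕ
∑ {zero}  f = 0
∑ {suc n} f = f zero + ∑ (f ∘ suc)

∑-mono-≤ : ∀ {n} {f g : Fin n → ℕ} → (∀ i → f i ≤ g i) → ∑ f ≤ ∑ g
∑-mono-≤ {zero}  f≤g = z≤n
∑-mono-≤ {suc n} f≤g = +-mono-≤ (f≤g zero) (∑-mono-≤ (f≤g ∘ suc))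

∑-mono-< : ∀ {n} {f g : Fin n → ℕ} → (∀ i → f i ≤ g i) → ∀ i → f i < g i → ∑ f < ∑ g
∑-mono-< f≤g zero    f<g = +-mono-<-≤ f<g (∑-mono-≤ (f≤g ∘ suc))
∑-mono-< f≤g (suc i) f<g = +-mono-≤-< (f≤g zero) (∑-mono-< (f≤g ∘ suc) i f<g)

⟦_⟧ᵇ : Bool → ℤ
⟦ true  ⟧ᵇ = 1ℤ
⟦ false ⟧ᵇ = 0ℤ

δ : ∀ {n} → Fin n → Fin n → ℤ
δ u v = ⟦ does (u ≟ᶠ v) ⟧ᵇ

lookup-⁅⁆ : ∀ {n} (u v : Fin n) → lookup ⁅ u ⁆ v ≡ does (v ≟ᶠ u)
lookup-⁅⁆ zero    zero    = refl
lookup-⁅⁆ zero    (suc v) = lookup-⊥ v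
  where
  lookup-⊥ : ∀ {n} (v : Fin n) → lookup (⊥) v ≡ false
  lookup-⊥ zero    = refl
  lookup-⊥ (suc v) = lookup-⊥ v
lookup-⁅⁆ (suc u) zero    = refl
lookup-⁅⁆ (suc u) (suc v) = lookup-⁅⁆ u v

lookup-─ : ∀ {n} (p q : Subset n) v → lookup (p ─ q) v ≡ lookup p v ∧ not (lookup q v)
lookup-─ (false ∷ p) (true  ∷ q) zero    = refl
lookup-─ (false ∷ p) (false ∷ q) zero    = refl
lookup-─ (true  ∷ p) (true  ∷ q) zero    = refl
lookup-─ (true  ∷ p) (false ∷ q) zero    = refl
lookup-─ (_ ∷ p)     (_ ∷ q)     (suc v) = lookup-─ p q v

lookup-ext : ∀ {A : Set} {n} {p q : Vec A n} → (∀ v → lookup p v ≡ lookup q v) → p ≡ q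
lookup-ext {p = p} {q} eq = trans (sym (tabulate∘lookup p)) (trans (tabulate-cong eq) (tabulate∘lookup q))

module _ {G : OrientedGraph} where
  private
    V = Fin (order G)
    variable
      I J S U : Subset (order G)

  -- The target is a parameter and the source an index, so that induction peels off the first slide.
  data Reach (U : Subset (order G)) : Subset (order G) → Set where
    done : Independent G U → Reach U U
    step : Independent G I → Slide G I J → Reach U J → Reach U I

  slide-count : ∀ {u v} → I ─ J ≡ ⁅ u ⁆ → J ─ I ≡ ⁅ v ⁆ →
                ∀ w → ⟦ lookup J w ⟧ᵇ ≡ ⟦ lookup I w ⟧ᵇ ℤ.+ δ w v ℤ.- δ w u
  slide-count {I} {J} {u} {v} out in′ w
    with lookup I w | lookup J w
       | trans (sym (lookup-─ I J w)) (trans (cong (λ p → lookup p w) out) (lookup-⁅⁆ u w))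
       | trans (sym (lookup-─ J I w)) (trans (cong (λ p → lookup p w) in′) (lookup-⁅⁆ v w))
  ... | true  | true  | p | q rewrite sym p | sym q = refl
  ... | true  | false | p | q rewrite sym p | sym q = refl
  ... | false | true  | p | q rewrite sym p | sym q = refl
  ... | false | false | p | q rewrite sym p | sym q = refl

  slide-into-free : ∀ {v} → J ─ I ≡ ⁅ v ⁆ → lookup I v ≡ false × lookup J v ≡ true
  slide-into-free {J} {I} {v} eq
    with lookup I v | lookup J v | v ≟ᶠ v
       | trans (sym (lookup-─ J I v)) (trans (cong (λ p → lookup p v) eq) (lookup-⁅⁆ v v))
  ... | _     | _     | no v≢v | _ = contradiction refl v≢v
  ... | false | true  | yes _ | _ = refl , refl
  ... | true  | true  | yes _ | ()
  ... | true  | false | yes _ | ()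
  ... | false | false | yes _ | ()

  slide-keeps : ∀ {u} → I ─ J ≡ ⁅ u ⁆ → ∀ {w} → w ≢ u → lookup I w ≡ true → lookup J w ≡ true
  slide-keeps {I} {J} {u} eq {w} w≢u w∈I
    with lookup I w | lookup J w | w ≟ᶠ u
       | trans (sym (lookup-─ I J w)) (trans (cong (λ p → lookup p w) eq) (lookup-⁅⁆ u w))
  ... | _     | _     | yes w≡u | _ = contradiction w≡u w≢u
  ... | true  | true  | no _    | _ = refl
  ... | true  | false | no _    | ()
  ... | false | _     | no _    | _ = contradiction w∈I λ ()

  start-independent : Reach U I → Independent G I
  start-independent (done ind)     = ind
  start-independent (step ind _ _) = ind

  module _ (K : CyclicOrder G) where
    open CyclicOrder K

    -- g u is the net number of tokens going from u to next u; the equation is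
    -- arranged so that no subtraction occurs.
    record Flow (S U : Subset (order G)) (g : V → ℤ) : Set where
      field
        conserved : ∀ u → g (next u) ℤ.+ ⟦ lookup U (next u) ⟧ᵇ ≡ g u ℤ.+ ⟦ lookup S (next u) ⟧ᵇ
        forward   : ∀ u → Arc G u (next u) → 0ℤ ℤ.≤ g u
        backward  : ∀ u → Arc G (next u) u → g u ℤ.≤ 0ℤ

    Gap : Subset (order G) → Set
    Gap S = ∃[ u ] (lookup S u ≡ false × lookup S (next u) ≡ false)

    independent-next : Independent G S → ∀ {u} → lookup S u ≡ true → lookup S (next u) ≡ false
    independent-next {S} ind {u} u∈S = ¬-not λ v∈S →
      ind u (next u) (lookup⇒[]= u S u∈S) (lookup⇒[]= (next u) S v∈S) (edge u)

    independent-prev : Independent G S → ∀ {u} → lookup S u ≡ true → lookup S (prev u) ≡ false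
    independent-prev {S} ind {u} u∈S = ¬-not λ v∈S →
      contradiction (trans (sym u∈S) (trans (cong (lookup S) (sym (next-prev u))) (independent-next ind v∈S))) λ ()

    independent : (∀ u → lookup S u ≡ true → lookup S (next u) ≢ true) → Independent G S
    independent {S} h u v u∈S v∈S e with edge⁻¹ u v e
    ... | inj₁ refl = h u ([]=⇒lookup u∈S) ([]=⇒lookup v∈S)
    ... | inj₂ refl = h v ([]=⇒lookup v∈S) (trans (cong (lookup S) (next-prev u)) ([]=⇒lookup u∈S))

    next≢id : ∀ u → next u ≢ u
    next≢id u eq = next²≢id u (trans (cong next eq) eq)

    δ-next : ∀ w u → δ (next w) (next u) ≡ δ w u
    δ-next w u with w ≟ᶠ u | next w ≟ᶠ next u
    ... | yes _    | yes _  = refl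
    ... | no  _    | no  _  = refl
    ... | yes refl | no ¬eq = contradiction refl ¬eq
    ... | no  w≢u  | yes eq = contradiction (next-injective eq) w≢u

  -- In the reversed order the edge leaving `u` is the one that used to enter it from `prev u`,
  -- crossed the other way: hence the shift of index and the sign.
  flow-mirror : (K : CyclicOrder G) → ∀ {g} → Flow K S U g →
                Flow (mirror K) S U (λ u → ℤ.- g (CyclicOrder.prev K u))
  flow-mirror {S} {U} K {g} F = record
    { conserved = λ u → solve′ (g (prev u)) _ (g (prev (prev u))) _
        (subst (λ v → g v ℤ.+ ⟦ lookup U v ⟧ᵇ ≡ g (prev (prev u)) ℤ.+ ⟦ lookup S v ⟧ᵇ)
          (next-prev (prev u)) (conserved (prev (prev u))))
    ; forward   = λ u a → ℤ.neg-mono-≤ (backward (prev u) (subst (λ v → Arc G v (prev u)) (sym (next-prev u)) a))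
    ; backward  = λ u a → ℤ.neg-mono-≤ (forward (prev u) (subst (λ v → Arc G (prev u) v) (sym (next-prev u)) a))
    }
    where
    open CyclicOrder K
    open Flow F
    solve′ : ∀ a b c d → a ℤ.+ b ≡ c ℤ.+ d → ℤ.- c ℤ.+ b ≡ ℤ.- a ℤ.+ d
    solve′ a b c d eq = begin
      ℤ.- c ℤ.+ b                             ≡⟨ lhs a b c ⟩
      (a ℤ.+ b) ℤ.+ (ℤ.- a ℤ.+ ℤ.- c)         ≡⟨ cong (ℤ._+ (ℤ.- a ℤ.+ ℤ.- c)) eq ⟩
      (c ℤ.+ d) ℤ.+ (ℤ.- a ℤ.+ ℤ.- c)         ≡⟨ rhs a c d ⟩
      ℤ.- a ℤ.+ d                             ∎
      where
      open ≡-Reasoning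
      lhs : ∀ a b c → ℤ.- c ℤ.+ b ≡ (a ℤ.+ b) ℤ.+ (ℤ.- a ℤ.+ ℤ.- c)
      lhs = solve-∀
      rhs : ∀ a c d → (c ℤ.+ d) ℤ.+ (ℤ.- a ℤ.+ ℤ.- c) ≡ ℤ.- a ℤ.+ d
      rhs = solve-∀

  flow-mirror⁻¹ : (K : CyclicOrder G) → ∀ {g} → Flow (mirror K) S U g →
                  Flow K S U (λ u → ℤ.- g (CyclicOrder.next K u))
  -- `mirror (mirror K)` has the same `next` as `K`, and `Flow` mentions nothing else of the order;
  -- its proof fields differ as terms, so the record is repacked.
  flow-mirror⁻¹ {S} {U} K F = record { conserved = conserved ; forward = forward ; backward = backward }
    where open Flow (flow-mirror {S} {U} (mirror K) F)

  gap-mirror : (K : CyclicOrder G) → Gap K S → Gap (mirror K) S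
  gap-mirror {S} K (u , p , q) = CyclicOrder.next K u , q , trans (cong (lookup S) (CyclicOrder.prev-next K u)) p

  -- Single slides and the search for a movable token

  module _ (K : CyclicOrder G) where
    open CyclicOrder K

    -- The gap consists of the two vertices ahead of the token: a token on the second one would stay
    -- in place and be adjacent to the token that has just arrived.
    slide-gap : ∀ {u} → I ─ J ≡ ⁅ u ⁆ → J ─ I ≡ ⁅ next u ⁆ → Independent G J → Gap K I
    slide-gap {I} {J} {u} out in′ indJ = next u , proj₁ (slide-into-free {J} {I} in′) , ¬-not λ w∈I →
      contradiction (trans (sym (slide-keeps {I} {J} out (next²≢id u) w∈I))
                           (independent-next K indJ (proj₂ (slide-into-free {J} {I} in′)))) λ ()

    -- Prepending a slide adds one unit on its edge. The sign conditions survive because `oneWay`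
    -- rules out the opposite arc there.
    flow-unslide : ∀ {u g} → Arc G u (next u) → I ─ J ≡ ⁅ u ⁆ → J ─ I ≡ ⁅ next u ⁆ →
                   Flow K J U g → Flow K I U (λ w → g w ℤ.+ δ w u)
    flow-unslide {I} {J} {U} {u} {g} arc out in′ F = record
      { conserved = λ w → solve′ (g (next w)) _ (g w) _ (δ (next w) u) (δ w u) (trans (conserved w)
          (cong (λ z → g w ℤ.+ z) (trans (slide-count {I} {J} out in′ (next w))
            (cong (λ d → ⟦ lookup I (next w) ⟧ᵇ ℤ.+ d ℤ.- δ (next w) u) (δ-next K w u)))))
      ; forward   = λ w a → ℤ.+-mono-≤ (forward w a) (0≤⟦⟧ᵇ (does (w ≟ᶠ u)))
      ; backward  = back
      }
      where
      open Flow F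
      0≤⟦⟧ᵇ : ∀ b → 0ℤ ℤ.≤ ⟦ b ⟧ᵇ
      0≤⟦⟧ᵇ true  = ℤ.+≤+ z≤n
      0≤⟦⟧ᵇ false = ℤ.+≤+ z≤n
      back : ∀ w → Arc G (next w) w → g w ℤ.+ δ w u ℤ.≤ 0ℤ
      back w a with w ≟ᶠ u
      ... | yes refl = contradiction arc (oneWay G (next w) w a)
      ... | no  _    = subst (ℤ._≤ 0ℤ) (sym (ℤ.+-identityʳ (g w))) (backward w a)
      solve′ : ∀ a b c d e f → a ℤ.+ b ≡ c ℤ.+ (d ℤ.+ f ℤ.- e) → a ℤ.+ e ℤ.+ b ≡ c ℤ.+ f ℤ.+ d
      solve′ a b c d e f eq = trans (lhs a b e) (trans (cong (ℤ._+ e) eq) (rhs c d e f))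
        where
        lhs : ∀ a b e → a ℤ.+ e ℤ.+ b ≡ a ℤ.+ b ℤ.+ e
        lhs = solve-∀
        rhs : ∀ c d e f → c ℤ.+ (d ℤ.+ f ℤ.- e) ℤ.+ e ≡ c ℤ.+ f ℤ.+ d
        rhs = solve-∀

    -- Positive flow on the edge serves twice: one unit can be removed without going below zero, and
    -- the arc cannot point backwards.
    flow-slide : ∀ {u g} → 0ℤ ℤ.< g u → I ─ J ≡ ⁅ u ⁆ → J ─ I ≡ ⁅ next u ⁆ →
                 Flow K I U g → Flow K J U (λ w → g w ℤ.- δ w u)
    flow-slide {I} {J} {U} {u} {g} 0<g out in′ F = record
      { conserved = λ w → trans (solve′ (g (next w)) _ (g w) _ (δ (next w) u) (δ w u) (conserved w))
          (cong (λ z → g w ℤ.- δ w u ℤ.+ z) (sym (trans (slide-count {I} {J} out in′ (next w))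
            (cong (λ d → ⟦ lookup I (next w) ⟧ᵇ ℤ.+ d ℤ.- δ (next w) u) (δ-next K w u)))))
      ; forward   = forw
      ; backward  = back
      }
      where
      open Flow F
      forw : ∀ w → Arc G w (next w) → 0ℤ ℤ.≤ g w ℤ.- δ w u
      forw w a with w ≟ᶠ u
      ... | yes refl = ℤ.i≤j⇒0≤j-i (ℤ.i<j⇒suc[i]≤j 0<g)
      ... | no  _    = subst (0ℤ ℤ.≤_) (sym (ℤ.+-identityʳ (g w))) (forward w a)
      back : ∀ w → Arc G (next w) w → g w ℤ.- δ w u ℤ.≤ 0ℤ
      back w a with w ≟ᶠ u
      ... | yes refl = contradiction (backward w a) (ℤ.<⇒≱ 0<g)
      ... | no  _    = subst (ℤ._≤ 0ℤ) (sym (ℤ.+-identityʳ (g w))) (backward w a)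
      solve′ : ∀ a b c d e f → a ℤ.+ b ≡ c ℤ.+ d → a ℤ.- e ℤ.+ b ≡ c ℤ.- f ℤ.+ (d ℤ.+ f ℤ.- e)
      solve′ a b c d e f eq = trans (lhs a b e) (trans (cong (ℤ._- e) eq) (rhs c d e f))
        where
        lhs : ∀ a b e → a ℤ.- e ℤ.+ b ≡ a ℤ.+ b ℤ.- e
        lhs = solve-∀
        rhs : ∀ c d e f → c ℤ.+ d ℤ.- e ≡ c ℤ.- f ℤ.+ (d ℤ.+ f ℤ.- e)
        rhs = solve-∀

    -- Independence already makes `next u` free, and after the slide its neighbour `u` is empty, so
    -- the vertex two places ahead is the only possible obstacle.
    module Move (ind : Independent G S) {u : V} (u∈S : lookup S u ≡ true)
                (free : lookup S (next (next u)) ≡ false) where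

      moved : Subset (order G)
      moved = (S [ u ]≔ false) [ next u ]≔ true

      moved-next : lookup moved (next u) ≡ true
      moved-next = lookup∘update (next u) (S [ u ]≔ false) true

      moved-source : lookup moved u ≡ false
      moved-source = trans (lookup∘update′ (next≢id K u ∘ sym) (S [ u ]≔ false) true) (lookup∘update u S false)

      moved-other : ∀ {w} → w ≢ u → w ≢ next u → lookup moved w ≡ lookup S w
      moved-other w≢u w≢v = trans (lookup∘update′ w≢v (S [ u ]≔ false) true) (lookup∘update′ w≢u S false)

      moved-⊆ : ∀ {w} → w ≢ next u → lookup moved w ≡ true → lookup S w ≡ true
      moved-⊆ {w} w≢v w∈J with w ≟ᶠ u
      ... | yes refl = u∈S
      ... | no  w≢u  = trans (sym (moved-other w≢u w≢v)) w∈J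

      moved-out : S ─ moved ≡ ⁅ u ⁆
      moved-out = lookup-ext λ w → trans (lookup-─ S moved w) (trans (cases w) (sym (lookup-⁅⁆ u w)))
        where
        cases : ∀ w → lookup S w ∧ not (lookup moved w) ≡ does (w ≟ᶠ u)
        cases w with w ≟ᶠ u | w ≟ᶠ next u
        ... | yes refl | _        rewrite u∈S | moved-source = refl
        ... | no _     | yes refl rewrite independent-next K {S = S} ind u∈S = refl
        ... | no w≢u   | no w≢v   rewrite moved-other w≢u w≢v with lookup S w
        ...   | true  = refl
        ...   | false = refl

      moved-in : moved ─ S ≡ ⁅ next u ⁆
      moved-in = lookup-ext λ w → trans (lookup-─ moved S w) (trans (cases w) (sym (lookup-⁅⁆ (next u) w)))
        where
        cases : ∀ w → lookup moved w ∧ not (lookup S w) ≡ does (w ≟ᶠ next u)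
        cases w with w ≟ᶠ u | w ≟ᶠ next u
        ... | yes refl | yes eq   = contradiction (sym eq) (next≢id K u)
        ... | yes refl | no _     rewrite moved-source = refl
        ... | no _     | yes refl rewrite moved-next | independent-next K {S = S} ind u∈S = refl
        ... | no w≢u   | no w≢v   rewrite moved-other w≢u w≢v with lookup S w
        ...   | true  = refl
        ...   | false = refl

      moved-independent : Independent G moved
      moved-independent = independent K cases
        where
        cases : ∀ w → lookup moved w ≡ true → lookup moved (next w) ≢ true
        cases w w∈J v∈J with w ≟ᶠ u | w ≟ᶠ next u
        ... | yes refl | _        = contradiction (trans (sym w∈J) moved-source) λ ()
        ... | no _     | yes refl = contradiction (trans (sym (moved-⊆ (next≢id K w) v∈J)) free) λ ()
        ... | no w≢u   | no w≢v   = contradiction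
          (trans (sym (moved-⊆ (w≢u ∘ next-injective) v∈J)) (independent-next K ind (moved-⊆ w≢v w∈J))) λ ()

      -- The vacated vertex and the one behind it, which was free as a neighbour of `u` and differs
      -- from `next u` because the cycle has at least three vertices.
      moved-gap : Gap K moved
      moved-gap = prev u
        , trans (moved-other (λ eq → next≢id K u (trans (cong next (sym eq)) (next-prev u))) p≢v)
                (independent-prev K ind u∈S)
        , trans (cong (lookup moved) (next-prev u)) moved-source
        where
        p≢v : prev u ≢ next u
        p≢v eq = next²≢id u (trans (cong next (sym eq)) (next-prev u))

    -- A token blocked by the one two places ahead of it passes its positive
    -- flow on to the blocking token, as the target is independent too.
    find-mover : ∀ {g} → Independent G S → Independent G U → Flow K S U g →
                 ∀ m u → lookup S u ≡ true → 0ℤ ℤ.< g u →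
                 lookup S (fold u next m) ≡ false → lookup S (next (fold u next m)) ≡ false →
                 ∃[ v ] (lookup S v ≡ true × 0ℤ ℤ.< g v × lookup S (next (next v)) ≡ false)
    -- `m` is the distance to the gap and drops by two per jump. Distance 0 would put the token
    -- inside the gap; at distance 1 the vertex two ahead is the second vertex of the gap.
    find-mover indS indU F zero          u u∈S 0<g p q = contradiction (trans (sym u∈S) p) λ ()
    find-mover indS indU F (suc zero)    u u∈S 0<g p q = u , u∈S , 0<g , q
    find-mover {S} {U} {g} indS indU F (suc (suc m)) u u∈S 0<g p q
      with lookup S (next (next u)) in w∈S
    ... | false = u , u∈S , 0<g , w∈S
    ... | true  = find-mover {g = g} indS indU F m (next (next u)) w∈S (ℤ.<-≤-trans 0<g grow)
                    (trans (cong (lookup S) (sym two)) p) (trans (cong (lookup S ∘ next) (sym two)) q)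
      where
      open Flow F
      two : fold u next (suc (suc m)) ≡ fold (next (next u)) next m
      two = trans (fold-peel u next (suc m)) (fold-peel (next u) next m)
      eq₁ = subst (λ b → g (next u) ℤ.+ ⟦ lookup U (next u) ⟧ᵇ ≡ g u ℤ.+ ⟦ b ⟧ᵇ)
              (independent-next K indS u∈S) (conserved u)
      eq₂ = subst (λ b → g (next (next u)) ℤ.+ ⟦ lookup U (next (next u)) ⟧ᵇ ≡ g (next u) ℤ.+ ⟦ b ⟧ᵇ)
              w∈S (conserved (next u))
      not-both : ∀ b c → (b ≡ true → c ≡ false) → ⟦ b ⟧ᵇ ℤ.+ ⟦ c ⟧ᵇ ℤ.≤ 0ℤ ℤ.+ 1ℤ
      not-both true  false _ = ℤ.≤-refl
      not-both false true  _ = ℤ.≤-refl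
      not-both false false _ = ℤ.+≤+ z≤n
      not-both true  true  h = contradiction (h refl) λ ()
      -- Add conservation at `next u` and at `next (next u)`: the current set contributes 0 + 1, the
      -- independent target at most 1.
      grow : g u ℤ.≤ g (next (next u))
      grow = +-transfer-≤ (add (g u) (g (next u)) (g (next (next u))) 0ℤ _ 1ℤ _ eq₁ eq₂)
               (not-both (lookup U (next u)) _ (independent-next K indU))
        where
        add : ∀ a b c p q r s → b ℤ.+ q ≡ a ℤ.+ p → c ℤ.+ s ≡ b ℤ.+ r → a ℤ.+ (p ℤ.+ r) ≡ c ℤ.+ (q ℤ.+ s)
        add a b c p q r s eq₁ eq₂ = trans (lhs a p r) (trans (cong (ℤ._+ r) (sym eq₁))
          (trans (mid b q r) (trans (cong (ℤ._+ q) (sym eq₂)) (rhs c q s))))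
          where
          lhs : ∀ a p r → a ℤ.+ (p ℤ.+ r) ≡ a ℤ.+ p ℤ.+ r
          lhs = solve-∀
          mid : ∀ b q r → b ℤ.+ q ℤ.+ r ≡ b ℤ.+ r ℤ.+ q
          mid = solve-∀
          rhs : ∀ c q s → c ℤ.+ s ℤ.+ q ≡ c ℤ.+ (q ℤ.+ s)
          rhs = solve-∀

  -- The decrease is stated pointwise, not for the sum, so that it passes through the reindexing by
  -- `mirror` without permuting a sum.
  record Advance (K : CyclicOrder G) (S U : Subset (order G)) (g : V → ℤ) : Set where
    field
      {after}        : Subset (order G)
      slide          : Slide G S after
      independent′   : Independent G after
      gap            : Gap K after
      {g′}           : V → ℤ
      flow           : Flow K after U g′
      ∣g′∣≤∣g∣       : ∀ w → ∣ g′ w ∣ ≤ ∣ g w ∣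
      ∣g′∣<∣g∣       : ∃[ w ] ∣ g′ w ∣ < ∣ g w ∣

  -- `find-mover` supplies an unblocked token, and positive flow on its edge forces the arc to point
  -- forwards.
  advance : (K : CyclicOrder G) → Independent G S → Independent G U → Gap K S → ∀ {g} → Flow K S U g →
            ∀ {u} → lookup S u ≡ true → 0ℤ ℤ.< g u → Advance K S U g
  advance {S} {U} K indS indU (x , x∉S , nx∉S) {g} F {u} u∈S 0<gu
    with m , eq ← CyclicOrder.reach K u x
    with v , v∈S , 0<gv , free ← find-mover K {S} {U} {g} indS indU F m u u∈S 0<gu
           (trans (cong (lookup S) eq) x∉S) (trans (cong (lookup S ∘ CyclicOrder.next K) eq) nx∉S) = record
    { slide        = v , next v , arc-v , moved-out , moved-in
    ; independent′ = moved-independent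
    ; gap          = moved-gap
    ; flow         = flow-slide K {S} {moved} {U} 0<gv moved-out moved-in F
    ; ∣g′∣≤∣g∣     = smaller
    ; ∣g′∣<∣g∣     = v , smaller-at-v
    }
    where
    open CyclicOrder K
    open Move K {S} indS v∈S free
    arc-v : Arc G v (next v)
    arc-v with edge v
    ... | inj₁ a = a
    ... | inj₂ a = contradiction (Flow.backward F v a) (ℤ.<⇒≱ 0<gv)
    dec : ∀ {i} → 0ℤ ℤ.< i → ∣ i ℤ.- 1ℤ ∣ < ∣ i ∣
    dec {+ suc n} _ = ≤-refl
    dec {+ zero} (ℤ.+<+ ())
    dec { -[1+ n ]} ()
    smaller : ∀ w → ∣ g w ℤ.- δ w v ∣ ≤ ∣ g w ∣
    smaller w with w ≟ᶠ v
    ... | yes refl = <⇒≤ (dec 0<gv)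
    ... | no  _    = ≤-reflexive (cong ∣_∣ (ℤ.+-identityʳ (g w)))
    smaller-at-v : ∣ g v ℤ.- δ v v ∣ < ∣ g v ∣
    smaller-at-v with v ≟ᶠ v
    ... | yes _  = dec 0<gv
    ... | no v≢v = contradiction refl v≢v

  advance-mirror : (K : CyclicOrder G) → ∀ {g} → let open CyclicOrder K in
                   Advance (mirror K) S U (λ u → ℤ.- g (prev u)) → Advance K S U g
  advance-mirror K {g} A = record
    { slide        = slide
    ; independent′ = independent′
    ; gap          = gap-mirror {after} (mirror K) gap
    ; flow         = flow-mirror⁻¹ K flow
    ; ∣g′∣≤∣g∣     = λ w → subst₂ _≤_ (sym (ℤ.∣-i∣≡∣i∣ (g′ (next w)))) (back w) (∣g′∣≤∣g∣ (next w))
    ; ∣g′∣<∣g∣     = let w , lt = ∣g′∣<∣g∣ in prev w ,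
        subst₂ _<_ (trans (sym (cong (∣_∣ ∘ g′) (next-prev w))) (sym (ℤ.∣-i∣≡∣i∣ (g′ (next (prev w))))))
                   (ℤ.∣-i∣≡∣i∣ (g (prev w))) lt
    }
    where
    open CyclicOrder K
    open Advance A
    back : ∀ w → ∣ ℤ.- g (prev (next w)) ∣ ≡ ∣ g w ∣
    back w = trans (ℤ.∣-i∣≡∣i∣ (g (prev (next w)))) (cong (∣_∣ ∘ g) (prev-next w))

  -- Reachability as a gap together with a flow

  module _ (K : CyclicOrder G) where
    open CyclicOrder K

    conserved′ : ∀ {g} → Flow K S U g → ∀ u → g u ℤ.+ ⟦ lookup U u ⟧ᵇ ≡ g (prev u) ℤ.+ ⟦ lookup S u ⟧ᵇ
    conserved′ {S} {U} {g} F u = subst (λ v → g v ℤ.+ ⟦ lookup U v ⟧ᵇ ≡ g (prev u) ℤ.+ ⟦ lookup S v ⟧ᵇ)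
      (next-prev u) (Flow.conserved F (prev u))

    -- Under the inclusion the flow never increases along `next`, and it drops strictly at a vertex
    -- of `U` outside `S`. Going once round from such a vertex gives a contradiction.
    flow-⊆ : ∀ {g} → Flow K S U g → (∀ u → lookup S u ≡ true → lookup U u ≡ true) → S ≡ U
    flow-⊆ {S} {U} {g} F S⊆U = lookup-ext equal
      where
      open Flow F
      ≤-⟦⟧ᵇ : ∀ b c → (b ≡ true → c ≡ true) → ⟦ b ⟧ᵇ ℤ.≤ ⟦ c ⟧ᵇ
      ≤-⟦⟧ᵇ false true  _ = ℤ.+≤+ z≤n
      ≤-⟦⟧ᵇ false false _ = ℤ.≤-refl
      ≤-⟦⟧ᵇ true  true  _ = ℤ.≤-refl
      ≤-⟦⟧ᵇ true  false h = contradiction (h refl) λ ()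
      shrinks : ∀ u → g (next u) ℤ.≤ g u
      shrinks u = +-transfer-≤ (conserved u) (≤-⟦⟧ᵇ _ _ (S⊆U (next u)))
      shrinks* : ∀ u m → g (fold u next m) ℤ.≤ g u
      shrinks* u zero    = ℤ.≤-refl
      shrinks* u (suc m) = ℤ.≤-trans (shrinks _) (shrinks* u m)
      equal : ∀ u → lookup S u ≡ lookup U u
      equal u with lookup S u in u∈S | lookup U u in u∈U
      ... | true  | true  = refl
      ... | false | false = refl
      ... | true  | false = contradiction (trans (sym (S⊆U u u∈S)) u∈U) λ ()
      ... | false | true  with m , eq ← reach u (prev u) = contradiction
        (subst (ℤ._≤ g u) (cong g eq) (shrinks* u m))
        (ℤ.<⇒≱ (ℤ.suc[i]≤j⇒i<j (ℤ.≤-reflexive (trans (ℤ.+-comm 1ℤ (g u))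
          (trans (subst₂ (λ b c → g u ℤ.+ ⟦ c ⟧ᵇ ≡ g (prev u) ℤ.+ ⟦ b ⟧ᵇ) u∈S u∈U (conserved′ {S} {U} F u))
                 (ℤ.+-identityʳ _))))))

    -- Induction on a strict bound `b` for the sum of absolute flow values, which each `Advance`
    -- lowers.
    flow⇒reach : Independent G U → ∀ b {S g} → ∑ (∣_∣ ∘ g) < b →
                 Independent G S → Gap K S → Flow K S U g → Reach U S
    flow⇒reach {U} indU (suc b) {S} {g} (s≤s Φ≤b) indS gap F
      with any? (λ u → (lookup S u ≟ᵇ true) ×-dec (lookup U u ≟ᵇ false))
    ... | no none = subst (Reach U) (sym (flow-⊆ {S} {U} F
            λ u u∈S → ¬-not λ u∉U → none (u , u∈S , u∉U))) (done indU)
    ... | yes (u , u∈S , u∉U) = continue adv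
      where
      -- At a token outside the target the flow rises by one. So either the edge ahead has positive
      -- flow, or the edge behind has negative flow and the mirrored order applies.
      rises : g (prev u) ℤ.< g u
      rises = ℤ.suc[i]≤j⇒i<j (ℤ.≤-reflexive (trans (ℤ.+-comm 1ℤ (g (prev u)))
        (sym (trans (sym (ℤ.+-identityʳ _))
          (subst₂ (λ b c → g u ℤ.+ ⟦ c ⟧ᵇ ≡ g (prev u) ℤ.+ ⟦ b ⟧ᵇ) u∈S u∉U (conserved′ {S} {U} F u))))))
      adv : Advance K S U g
      adv with 0ℤ ℤ.<? g u
      ... | yes 0<g = advance K indS indU gap F u∈S 0<g
      ... | no  0≮g = advance-mirror K (advance (mirror K) indS indU (gap-mirror {S} K gap)
                        (flow-mirror K F) u∈S (ℤ.neg-mono-< (ℤ.<-≤-trans rises (ℤ.≮⇒≥ 0≮g))))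
      continue : Advance K S U g → Reach U S
      continue A = step indS slide (flow⇒reach indU b
        (<-≤-trans (∑-mono-< ∣g′∣≤∣g∣ (proj₁ ∣g′∣<∣g∣) (proj₂ ∣g′∣<∣g∣)) Φ≤b) independent′ gap′ flow)
        where open Advance A renaming (gap to gap′)

    reach⇒flow : Reach U S → ∃ (Flow K S U)
    reach⇒flow (done _) = (λ _ → 0ℤ) , record
      { conserved = λ _ → refl ; forward = λ _ _ → ℤ.≤-refl ; backward = λ _ _ → ℤ.≤-refl }
    reach⇒flow {U} (step {I = I} {J = J} ind (u , v , arc , out , in′) r)
      with g , F ← reach⇒flow r | edge⁻¹ u v (inj₁ arc)
    ... | inj₁ refl = _ , flow-unslide K {I} {J} {U} arc out in′ F
    -- A slide towards `prev` is a forward slide of the mirrored order.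
    ... | inj₂ refl = _ , flow-mirror⁻¹ K (flow-unslide (mirror K) {I} {J} {U} arc out in′ (flow-mirror K F))

    reach⇒gap : Reach U S → S ≡ U ⊎ Gap K S
    reach⇒gap (done _) = inj₁ refl
    reach⇒gap (step {I = I} {J = J} ind (u , v , arc , out , in′) r) with edge⁻¹ u v (inj₁ arc)
    ... | inj₁ refl = inj₂ (slide-gap K {I} {J} out in′ (start-independent r))
    ... | inj₂ refl = inj₂ (gap-mirror {I} (mirror K) (slide-gap (mirror K) {I} {J} out in′ (start-independent r)))

    -- Equality is a separate case because a set without a gap is frozen and yet reaches itself.
    reach⇔ : Independent G S → Independent G U → Reach U S ⇔ (S ≡ U ⊎ (Gap K S × ∃ (Flow K S U)))
    reach⇔ {S} {U} indS indU = mk⇔ to from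
      where
      to : Reach U S → S ≡ U ⊎ (Gap K S × ∃ (Flow K S U))
      to r with reach⇒gap r
      ... | inj₁ eq  = inj₁ eq
      ... | inj₂ gap = inj₂ (gap , reach⇒flow r)
      from : S ≡ U ⊎ (Gap K S × ∃ (Flow K S U)) → Reach U S
      from (inj₁ refl)              = done indS
      from (inj₂ (gap , g , F)) = flow⇒reach indU (suc (∑ (∣_∣ ∘ g))) ≤-refl indS gap F

-- Indexed reconfiguration sequences and `Reach`

yes⇒reach : ∀ x → YesInstance x → Reach {graph x} (target x) (source x)
yes⇒reach x (ℓ , I , start , end , ind , sl) = subst (Reach {graph x} (target x)) start (go ℓ I end ind sl)
  where
  G = graph x
  go : ∀ ℓ (I : Fin (suc ℓ) → Subset (order G)) → I (fromℕ ℓ) ≡ target x → (∀ i → Independent G (I i)) →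
       (∀ (i : Fin ℓ) → Slide G (I (inject₁ i)) (I (suc i))) → Reach {graph x} (target x) (I zero)
  go zero    I end ind sl = subst (Reach {graph x} (target x)) (sym end) (done (targetIndep x))
  go (suc ℓ) I end ind sl = step (ind zero) (sl zero) (go ℓ (I ∘ suc) end (ind ∘ suc) (sl ∘ suc))

reach⇒yes : ∀ x → Reach {graph x} (target x) (source x) → YesInstance x
reach⇒yes x r = go r
  where
  G = graph x
  go : ∀ {S} → Reach {graph x} (target x) S → Σ[ ℓ ∈ ℕ ] Σ[ I ∈ (Fin (suc ℓ) → Subset (order G)) ]
    (I zero ≡ S × I (fromℕ ℓ) ≡ target x × (∀ i → Independent G (I i))
    × (∀ (i : Fin ℓ) → Slide G (I (inject₁ i)) (I (suc i))))
  go (done ind) = 0 , (λ _ → target x) , refl , refl , (λ _ → ind) , λ ()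
  go (step {I = S} ind sl r) with ℓ , I , refl , end , inds , sls ← go r =
    suc ℓ , (λ { zero → S ; (suc i) → I i }) , refl , end ,
    (λ { zero → ind ; (suc i) → inds i }) , (λ { zero → sl ; (suc i) → sls i })

-- The cyclic order of an oriented cycle

CyclicSucc-functional : ∀ {n} {i j j′ : Fin n} → CyclicSucc i j → CyclicSucc i j′ → j ≡ j′
CyclicSucc-functional          (inj₁ p)       (inj₁ q)        = toℕ-injective (trans (sym p) q)
CyclicSucc-functional {j = j}  (inj₁ p)       (inj₂ (q , _))  = contradiction (trans (sym p) q) (<⇒≢ (toℕ<n j))
CyclicSucc-functional {j′ = j} (inj₂ (p , _)) (inj₁ q)        = contradiction (trans (sym q) p) (<⇒≢ (toℕ<n j))
CyclicSucc-functional          (inj₂ (_ , p)) (inj₂ (_ , q))  = toℕ-injective (trans p (sym q))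

CyclicSucc-injective : ∀ {n} {i i′ j : Fin n} → CyclicSucc i j → CyclicSucc i′ j → i ≡ i′
CyclicSucc-injective (inj₁ p)       (inj₁ q)       = toℕ-injective (suc-injective (trans p (sym q)))
CyclicSucc-injective (inj₁ p)       (inj₂ (_ , q)) = contradiction (trans p q) λ ()
CyclicSucc-injective (inj₂ (_ , p)) (inj₁ q)       = contradiction (trans q p) λ ()
CyclicSucc-injective (inj₂ (p , _)) (inj₂ (q , _)) = toℕ-injective (suc-injective (trans p (sym q)))

-- That these are mutually inverse is not computed: `CyclicSucc` is functional and injective and
-- pins both down.
rotate rotate⁻¹ : ∀ {n} → Fin n → Fin n
rotate {suc n} i with suc (toℕ i) <? suc n
... | yes i<n = fromℕ< i<n
... | no  _   = zero
rotate⁻¹ {suc n} zero    = fromℕ n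
rotate⁻¹ {suc n} (suc i) = inject₁ i

CyclicSucc-rotate : ∀ {n} (i : Fin n) → CyclicSucc i (rotate i)
CyclicSucc-rotate {suc n} i with suc (toℕ i) <? suc n
... | yes i<n = inj₁ (sym (toℕ-fromℕ< i<n))
... | no  i≮n = inj₂ (≤-antisym (toℕ<n i) (≮⇒≥ i≮n) , refl)

CyclicSucc-rotate⁻¹ : ∀ {n} (i : Fin n) → CyclicSucc (rotate⁻¹ i) i
CyclicSucc-rotate⁻¹ {suc n} zero    = inj₂ (cong suc (toℕ-fromℕ n) , refl)
CyclicSucc-rotate⁻¹ {suc n} (suc i) = inj₁ (cong suc (toℕ-inject₁ i))

rotate-from-zero : ∀ {n} (i : Fin (suc n)) → fold zero rotate (toℕ i) ≡ i
rotate-from-zero {n} i = toℕ-injective (go (toℕ i) (toℕ<n i))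
  where
  go : ∀ m → m < suc n → toℕ (fold zero rotate m) ≡ m
  go zero    _   = refl
  go (suc m) m<n with CyclicSucc-rotate {suc n} (fold zero rotate m)
  ... | inj₁ p       = trans (sym p) (cong suc (go m (<⇒≤ m<n)))
  ... | inj₂ (p , _) = contradiction (trans (cong suc (sym (go m (<⇒≤ m<n)))) p) (<⇒≢ m<n)

-- `d` is the distance to the last index `n`, from which one more rotation wraps to zero.
rotate-to-zero : ∀ {n} d (i : Fin (suc n)) → toℕ i + d ≡ n → ∃[ m ] fold i rotate m ≡ zero
rotate-to-zero {n} zero    i eq = 1 , CyclicSucc-functional (CyclicSucc-rotate i)
  (inj₂ (cong suc (trans (sym (+-identityʳ _)) eq) , refl))
rotate-to-zero {n} (suc d) i eq with CyclicSucc-rotate i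
... | inj₁ p       =
  let m , q = rotate-to-zero d (rotate i) (trans (cong (_+ d) (sym p)) (trans (sym (+-suc (toℕ i) d)) eq))
  in  suc m , trans (fold-peel i rotate m) q
... | inj₂ (p , _) = contradiction (trans eq (suc-injective (sym p))) (m+1+n≢m (toℕ i))

rotate-reach : ∀ {n} (i j : Fin n) → ∃[ m ] fold i rotate m ≡ j
rotate-reach {suc n} i j =
  let m , p = rotate-to-zero (n ∸ toℕ i) i (m+[n∸m]≡n (≤-pred (toℕ<n i)))
  in  toℕ j + m , trans (fold-+ i rotate (toℕ j))
        (trans (cong (λ k → fold k rotate (toℕ j)) p) (rotate-from-zero j))

cyclicOrder : ∀ G → IsOrientedCycle G → CyclicOrder G
cyclicOrder G (3≤n , π , und) = record
  { next      = next
  ; prev      = prev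
  ; next-prev = λ u → trans (cong (λ i → π ⟨$⟩ʳ rotate i) (inverseˡ π))
      (trans (cong (π ⟨$⟩ʳ_) (CyclicSucc-functional (CyclicSucc-rotate _) (CyclicSucc-rotate⁻¹ _))) (inverseʳ π))
  ; prev-next = λ u → trans (cong (λ i → π ⟨$⟩ʳ rotate⁻¹ i) (inverseˡ π))
      (trans (cong (π ⟨$⟩ʳ_) (CyclicSucc-injective (CyclicSucc-rotate⁻¹ _) (CyclicSucc-rotate _))) (inverseʳ π))
  ; reach     = λ u v → let m , p = rotate-reach (π ⟨$⟩ˡ u) (π ⟨$⟩ˡ v) in
      m , trans (trans (cong (λ w → fold w next m) (sym (inverseʳ π))) (next^ (π ⟨$⟩ˡ u) m))
                (trans (cong (π ⟨$⟩ʳ_) p) (inverseʳ π))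
  ; edge      = λ u → subst (λ v → Und G v (next u)) (inverseʳ π)
      (Equivalence.from (und (π ⟨$⟩ˡ u) (rotate (π ⟨$⟩ˡ u))) (inj₁ (CyclicSucc-rotate _)))
  ; edge⁻¹    = neighbours
  ; 3≤order   = 3≤n
  }
  where
  next prev : Fin (order G) → Fin (order G)
  next u = π ⟨$⟩ʳ rotate (π ⟨$⟩ˡ u)
  prev u = π ⟨$⟩ʳ rotate⁻¹ (π ⟨$⟩ˡ u)
  next^ : ∀ i m → fold (π ⟨$⟩ʳ i) next m ≡ π ⟨$⟩ʳ fold i rotate m
  next^ i zero    = refl
  next^ i (suc m) = trans (cong next (next^ i m)) (cong (λ j → π ⟨$⟩ʳ rotate j) (inverseˡ π))
  neighbours : ∀ u v → Und G u v → v ≡ next u ⊎ v ≡ prev u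
  neighbours u v e with Equivalence.to (und (π ⟨$⟩ˡ u) (π ⟨$⟩ˡ v))
                          (subst₂ (Und G) (sym (inverseʳ π)) (sym (inverseʳ π)) e)
  ... | inj₁ s = inj₁ (trans (sym (inverseʳ π)) (cong (π ⟨$⟩ʳ_) (CyclicSucc-functional s (CyclicSucc-rotate _))))
  ... | inj₂ s = inj₂ (trans (sym (inverseʳ π)) (cong (π ⟨$⟩ʳ_) (CyclicSucc-injective s (CyclicSucc-rotate⁻¹ _))))

-- The flow criterion along a walk

-- What the decision procedure needs to know about a vertex u: whether u and
-- next u carry a source token, whether u carries a target token, and whether
-- the edge between u and next u is directed towards next u.
record Entry : Set where
  constructor entry
  field
    here₀ here₁ wanted forwards : Bool
open Entry

misplaced uncovered : Entry → Bool
misplaced e = here₀ e xor wanted e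
uncovered e = not (here₀ e) ∧ not (here₁ e)

-- The flow into a vertex, given the flow out of it: entry lists are processed
-- from the last vertex of a walk back to the first.
before : Entry → ℤ → ℤ
before e h = h ℤ.- ⟦ here₀ e ⟧ᵇ ℤ.+ ⟦ wanted e ⟧ᵇ

allowed : Entry → ℤ → Bool
allowed (entry _ _ _ true)  h = 0ℤ ℤ.≤ᵇ h
allowed (entry _ _ _ false) h = h ℤ.≤ᵇ 0ℤ

total : ℤ → List Entry → ℤ
total h []      = h
total h (e ∷ L) = total (before e h) L

feasible : ℤ → List Entry → Bool
feasible h []      = true
feasible h (e ∷ L) = allowed e h ∧ feasible (before e h) L

isZero : ℤ → Bool
isZero (+ zero) = true
isZero _        = false

-- The starting value enters `total` only as an added constant, so balance is tested once, at `0ℤ`.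
-- The candidates for the constant lie strictly between -n and n, which suffices by `flow-clamp₊₋`.
decide : ℕ → List Entry → Bool
decide n L = not (any misplaced L) ∨
  (any uncovered L ∧ isZero (total 0ℤ L) ∧ any (λ k → feasible (+ k) L ∨ feasible (ℤ.- + k) L) (downFrom n))

any-downFrom⁺ : ∀ (q : ℕ → Bool) {n k} → k < n → T (q k) → T (any q (downFrom n))
any-downFrom⁺ q {suc n} {k} (s≤s k≤n) t with k ≟ n
... | yes refl = Equivalence.from T-∨ (inj₁ t)
... | no  k≢n  = Equivalence.from T-∨ (inj₂ (any-downFrom⁺ q (≤∧≢⇒< k≤n k≢n) t))

any-downFrom⁻ : ∀ (q : ℕ → Bool) {n} → T (any q (downFrom n)) → ∃[ k ] (k < n × T (q k))
any-downFrom⁻ q {suc n} t with Equivalence.to T-∨ t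
... | inj₁ t′ = n , ≤-refl , t′
... | inj₂ t′ = let k , k<n , qk = any-downFrom⁻ q {n} t′ in k , <-trans k<n ≤-refl , qk

any-map : ∀ {A B : Set} (p : B → Bool) (f : A → B) xs → any p (map f xs) ≡ any (p ∘ f) xs
any-map p f []       = refl
any-map p f (x ∷ xs) = cong (p (f x) ∨_) (any-map p f xs)

-- A vertex absorbs at most one target token, which bounds the drop of the flow there.
flow-step-≤ : ∀ {a b} s t → a ℤ.+ ⟦ t ⟧ᵇ ≡ b ℤ.+ ⟦ s ⟧ᵇ → b ℤ.≤ a ℤ.+ 1ℤ
flow-step-≤ {a} {b} s t eq = +-transfer-≤ {k = ⟦ s ⟧ᵇ} {l = ⟦ t ⟧ᵇ ℤ.- 1ℤ}
  (trans (sym eq) (shift a ⟦ t ⟧ᵇ)) (small s t)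
  where
  shift : ∀ a t → a ℤ.+ t ≡ a ℤ.+ 1ℤ ℤ.+ (t ℤ.- 1ℤ)
  shift = solve-∀
  small : ∀ s t → ⟦ t ⟧ᵇ ℤ.- 1ℤ ℤ.≤ ⟦ s ⟧ᵇ
  small true  true  = ℤ.+≤+ z≤n
  small true  false = ℤ.-≤+
  small false true  = ℤ.≤-refl
  small false false = ℤ.-≤+

module _ {G : OrientedGraph} {S U : Subset (order G)} where
  private V = Fin (order G)

  -- Every vertex is fewer than `n` steps from `u`, and each step loses at most one, so the flow is
  -- at least `z = k + 1 - n > 0` everywhere. Then no arc points backwards, and subtracting `z`
  -- throughout leaves a flow with value `n - 1` at `u`.
  flow-clamp : (K : CyclicOrder G) → ∀ {g} → Flow K S U g → ∀ u {k} → g u ≡ + k → order G ≤ k →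
               ∃[ g′ ] ∃[ k′ ] (Flow K S U g′ × k′ < order G × g′ u ≡ + k′)
  flow-clamp K {g} F u {k} gu≡k n≤k = (λ v → g v ℤ.- + z) , k ∸ z , record
    { conserved = λ v → solve′ (g (next v)) _ (g v) _ (+ z) (conserved v)
    ; forward   = λ v _ → ℤ.i≤j⇒0≤j-i (big v)
    ; backward  = λ v a → contradiction (ℤ.≤-trans (big v) (backward v a)) (z≰0)
    } , small , trans (cong (ℤ._- + z) gu≡k) (trans (ℤ.m-n≡m⊖n k z) (ℤ.⊖-≥ z≤k))
    where
    open CyclicOrder K
    open Flow F
    n = order G
    z = suc k ∸ n
    z≤k : z ≤ k
    z≤k = ∸-monoʳ-≤ {suc 0} {n} (suc k) (≤-trans (s≤s z≤n) 3≤order)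
    small : k ∸ z < n
    small = ≤-reflexive (trans (sym (+-∸-assoc 1 z≤k)) (m∸[m∸n]≡n (≤-trans n≤k (n≤1+n k))))
    z≰0 : ¬ (+ z ℤ.≤ 0ℤ)
    z≰0 (ℤ.+≤+ z≤0) = contradiction (n≤0⇒n≡0 z≤0) (m>n⇒m∸n≢0 (s≤s n≤k))
    lower : ∀ m → + k ℤ.≤ g (fold u next m) ℤ.+ + m
    lower zero    = ℤ.≤-reflexive (trans (sym gu≡k) (sym (ℤ.+-identityʳ _)))
    lower (suc m) = ℤ.≤-trans (lower m)
      (subst (g v ℤ.+ + m ℤ.≤_) (ℤ.+-assoc (g (next v)) 1ℤ (+ m))
        (ℤ.+-monoˡ-≤ (+ m) (flow-step-≤ {g (next v)} {g v} (lookup S (next v)) _ (conserved v))))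
      where v = fold u next m
    big : ∀ v → + z ℤ.≤ g v
    big v with m , m<n , refl ← position u v = begin
      + (suc k ∸ n)                         ≤⟨ ℤ.+≤+ (∸-monoʳ-≤ (suc k) m<n) ⟩
      + (k ∸ m)                             ≡⟨ trans (ℤ.m-n≡m⊖n k m) (ℤ.⊖-≥ (≤-trans (<⇒≤ m<n) n≤k)) ⟨
      + k ℤ.- + m                           ≤⟨ ℤ.+-monoˡ-≤ (ℤ.- + m) (lower m) ⟩
      g (fold u next m) ℤ.+ + m ℤ.- + m     ≡⟨ cancel (g (fold u next m)) (+ m) ⟩
      g (fold u next m)                     ∎
      where
      open ℤ.≤-Reasoning
      cancel : ∀ a b → a ℤ.+ b ℤ.- b ≡ a
      cancel = solve-∀
    solve′ : ∀ a b c d e → a ℤ.+ b ≡ c ℤ.+ d → a ℤ.- e ℤ.+ b ≡ c ℤ.- e ℤ.+ d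
    solve′ a b c d e eq = trans (swap′ a b e) (trans (cong (ℤ._- e) eq) (sym (swap′ c d e)))
      where
      swap′ : ∀ a b e → a ℤ.- e ℤ.+ b ≡ a ℤ.+ b ℤ.- e
      swap′ = solve-∀

  flow-clamp₊₋ : (K : CyclicOrder G) → ∃ (Flow K S U) → ∀ u →
                 ∃[ g ] ∃[ k ] (Flow K S U g × k < order G × (g u ≡ + k ⊎ g u ≡ ℤ.- + k))
  flow-clamp₊₋ K (g , F) u with g u in eq
  ... | + k with k <? order G
  ...   | yes k<n = g , k , F , k<n , inj₁ eq
  ...   | no  k≮n =
    let g′ , k′ , F′ , k′<n , eq′ = flow-clamp K F u eq (≮⇒≥ k≮n)
    in  g′ , k′ , F′ , k′<n , inj₁ eq′
  flow-clamp₊₋ K (g , F) u | -[1+ k ] with suc k <? order G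
  ...   | yes k<n = g , suc k , F , k<n , inj₂ eq
  ...   | no  k≮n =
    let open CyclicOrder K
        -- In the mirrored order the edge between `u` and `next u` is indexed by `next u`, and its
        -- flow is positive.
        g′ , k′ , F′ , k′<n , eq′ = flow-clamp (mirror K) (flow-mirror K F) (next u)
          (trans (cong (λ v → ℤ.- g v) (prev-next u)) (cong ℤ.-_ eq)) (≮⇒≥ k≮n)
    in  _ , k′ , flow-mirror⁻¹ K F′ , k′<n , inj₂ (cong ℤ.-_ eq′)

  module Trail (K : CyclicOrder G) (v₀ : V) where
    open CyclicOrder K

    at : ℕ → V
    at = fold v₀ next

    entryAt : V → Entry
    entryAt u = entry (lookup S u) (lookup S (next u)) (lookup U u) (arc G u (next u))

    -- Latest vertex first, since the walk conses each new entry onto the front.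
    trail : ℕ → List Entry
    trail j = map (entryAt ∘ at) (downFrom j)

    any-trail⁺ : ∀ p u → T (p (entryAt u)) → T (any p (trail (order G)))
    any-trail⁺ p u t with m , m<n , refl ← position v₀ u =
      subst T (sym (any-map p (entryAt ∘ at) (downFrom (order G)))) (any-downFrom⁺ (p ∘ entryAt ∘ at) m<n t)

    any-trail⁻ : ∀ p → T (any p (trail (order G))) → ∃[ u ] T (p (entryAt u))
    any-trail⁻ p t =
      let m , _ , t′ = any-downFrom⁻ (p ∘ entryAt ∘ at) {order G}
            (subst T (any-map p (entryAt ∘ at) (downFrom (order G))) t)
      in  at m , t′

    module _ {g} (F : Flow K S U g) where
      open Flow F

      before-flow : ∀ u z → before (entryAt u) (g u ℤ.+ z) ≡ g (prev u) ℤ.+ z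
      before-flow u z = solve′ (g u) _ _ (g (prev u)) z (conserved′ K {S} {U} F u)
        where
        solve′ : ∀ a s t b z → a ℤ.+ t ≡ b ℤ.+ s → a ℤ.+ z ℤ.- s ℤ.+ t ≡ b ℤ.+ z
        solve′ a s t b z eq = trans (lhs a s t z) (trans (cong (λ x → x ℤ.- s ℤ.+ z) eq) (rhs b s z))
          where
          lhs : ∀ a s t z → a ℤ.+ z ℤ.- s ℤ.+ t ≡ a ℤ.+ t ℤ.- s ℤ.+ z
          lhs = solve-∀
          rhs : ∀ b s z → b ℤ.+ s ℤ.- s ℤ.+ z ≡ b ℤ.+ z
          rhs = solve-∀

      before-flow₀ : ∀ u → before (entryAt u) (g u) ≡ g (prev u)
      before-flow₀ u = trans (cong (before (entryAt u)) (sym (ℤ.+-identityʳ (g u))))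
                             (trans (before-flow u 0ℤ) (ℤ.+-identityʳ _))

      -- A constant shift passes through the sweep. Taking `z` as minus the flow into `v₀` gives the
      -- balance test, which starts at zero.
      total-flow : ∀ z j → total (g (prev (at j)) ℤ.+ z) (trail j) ≡ g (prev v₀) ℤ.+ z
      total-flow z zero    = refl
      total-flow z (suc j) = trans
        (cong (λ h → total h (trail j))
          (trans (cong (λ v → before (entryAt (at j)) (g v ℤ.+ z)) (prev-next (at j))) (before-flow (at j) z)))
        (total-flow z j)

      allowed-flow : ∀ u → T (allowed (entryAt u) (g u))
      allowed-flow u with arc G u (next u) | forward u | backward u | edge u
      ... | true  | f | _ | _      = ℤ.≤⇒≤ᵇ (f _)
      ... | false | _ | b | inj₂ a = ℤ.≤⇒≤ᵇ (b a)

      feasible-flow : ∀ j → T (feasible (g (prev (at j))) (trail j))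
      feasible-flow zero    = _
      feasible-flow (suc j) rewrite prev-next (at j) = Equivalence.from T-∧
        ( allowed-flow (at j)
        , subst (λ h → T (feasible h (trail j))) (sym (before-flow₀ (at j))) (feasible-flow j))

    -- The flow into the j-th vertex of the trail, relative to the flow into v₀.
    drift : ℕ → ℤ
    drift zero    = 0ℤ
    drift (suc j) = drift j ℤ.+ ⟦ lookup S (at j) ⟧ᵇ ℤ.- ⟦ lookup U (at j) ⟧ᵇ

    before-drift : ∀ c j → before (entryAt (at j)) (c ℤ.+ drift (suc j)) ≡ c ℤ.+ drift j
    before-drift c j = solve′ c (drift j) ⟦ lookup S (at j) ⟧ᵇ ⟦ lookup U (at j) ⟧ᵇ
      where
      solve′ : ∀ c d s t → c ℤ.+ (d ℤ.+ s ℤ.- t) ℤ.- s ℤ.+ t ≡ c ℤ.+ d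
      solve′ = solve-∀

    total-drift : ∀ c j → total (c ℤ.+ drift j) (trail j) ≡ c
    total-drift c zero    = ℤ.+-identityʳ c
    total-drift c (suc j) = trans (cong (λ h → total h (trail j)) (before-drift c j)) (total-drift c j)

    feasible-drift : ∀ c j → T (feasible (c ℤ.+ drift j) (trail j)) →
                     ∀ {i} → i < j → T (allowed (entryAt (at i)) (c ℤ.+ drift (suc i)))
    feasible-drift c (suc j) t {i} (s≤s i≤j) with Equivalence.to T-∧ t | i ≟ j
    ... | t₁ , _  | yes refl = t₁
    ... | _  , t₂ | no  i≢j  = feasible-drift c j
      (subst (λ h → T (feasible h (trail j))) (before-drift c j) t₂) (≤∧≢⇒< i≤j i≢j)

    -- Starting at zero is the case `c = - drift n` of `total-drift`, so the balance test returns
    -- minus the drift of a full turn.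
    drift-period : total 0ℤ (trail (order G)) ≡ 0ℤ → drift (order G) ≡ 0ℤ
    drift-period eq = trans (sym (ℤ.neg-involutive _)) (cong ℤ.-_ (trans (sym (total-drift _ (order G)))
      (trans (cong (λ h → total h (trail (order G))) (ℤ.+-inverseˡ (drift (order G)))) eq)))

    feasible⇒flow : ∀ c → total 0ℤ (trail (order G)) ≡ 0ℤ → T (feasible c (trail (order G))) → ∃ (Flow K S U)
    feasible⇒flow c balanced t = g , record
      { conserved = kept
      ; forward   = λ u a → forw (allowed-g u) a
      ; backward  = λ u a → backw (allowed-g u) (λ b → oneWay G u (next u) b a)
      }
      where
      n = order G
      index : V → ℕ
      index u = proj₁ (position v₀ u)
      index<n : ∀ u → index u < n
      index<n u = proj₁ (proj₂ (position v₀ u))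
      at-index : ∀ u → at (index u) ≡ u
      at-index u = proj₂ (proj₂ (position v₀ u))
      g : V → ℤ
      g u = c ℤ.+ drift (suc (index u))
      all-allowed : ∀ {i} → i < n → T (allowed (entryAt (at i)) (c ℤ.+ drift (suc i)))
      all-allowed = feasible-drift c n (subst (λ h → T (feasible h (trail n)))
        (sym (trans (cong (λ d → c ℤ.+ d) (drift-period balanced)) (ℤ.+-identityʳ c))) t)
      allowed-g : ∀ u → T (allowed (entryAt u) (g u))
      allowed-g u = subst (λ v → T (allowed (entryAt v) (g u))) (at-index u) (all-allowed (index<n u))
      forw : ∀ {u h} → T (allowed (entryAt u) h) → Arc G u (next u) → 0ℤ ℤ.≤ h
      forw {u} t a with true ← arc G u (next u) = ℤ.≤ᵇ⇒≤ t
      backw : ∀ {u h} → T (allowed (entryAt u) h) → ¬ Arc G u (next u) → h ℤ.≤ 0ℤ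
      backw {u} t ¬a with arc G u (next u)
      ... | true  = contradiction _ ¬a
      ... | false = ℤ.≤ᵇ⇒≤ t
      -- Past the last index the next vertex is `v₀`, whose index is 0. The two drifts then agree
      -- only because a full turn has drift zero.
      drift-next : ∀ u → drift (index (next u)) ≡ drift (suc (index u))
      drift-next u with suc (index u) <? n
      ... | yes i<n = cong drift (next^-unique v₀ (index<n (next u)) i<n
                        (trans (at-index (next u)) (cong next (sym (at-index u)))))
      ... | no  i≮n = trans (cong drift (next^-unique v₀ {j = 0} (index<n (next u)) (≤-<-trans z≤n (index<n u))
                        (trans (at-index (next u)) (trans (cong next (sym (at-index u)))
                          (trans (cong at wrap) (period v₀))))))
                        (sym (trans (cong drift wrap) (drift-period balanced)))
        where wrap = ≤-antisym (index<n u) (≮⇒≥ i≮n)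
      kept : ∀ u → g (next u) ℤ.+ ⟦ lookup U (next u) ⟧ᵇ ≡ g u ℤ.+ ⟦ lookup S (next u) ⟧ᵇ
      kept u = trans
        (cong (λ v → c ℤ.+ (drift (index (next u)) ℤ.+ ⟦ lookup S v ⟧ᵇ ℤ.- ⟦ lookup U v ⟧ᵇ)
                       ℤ.+ ⟦ lookup U (next u) ⟧ᵇ)
          (at-index (next u)))
        (trans (cancel c _ _ ⟦ lookup U (next u) ⟧ᵇ)
          (cong (λ d → c ℤ.+ d ℤ.+ ⟦ lookup S (next u) ⟧ᵇ) (drift-next u)))
        where
        cancel : ∀ c d s t → c ℤ.+ (d ℤ.+ s ℤ.- t) ℤ.+ t ≡ c ℤ.+ d ℤ.+ s
        cancel = solve-∀

    decide-correct : T (decide (order G) (trail (order G))) ⇔ (S ≡ U ⊎ (Gap K S × ∃ (Flow K S U)))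
    decide-correct = mk⇔ to from
      where
      n = order G
      L = trail n
      signed : ℕ → Bool
      signed k = feasible (+ k) L ∨ feasible (ℤ.- + k) L
      xor-≡ : ∀ a b → ¬ T (a xor b) → a ≡ b
      xor-≡ true  true  _ = refl
      xor-≡ false false _ = refl
      xor-≡ true  false h = contradiction _ h
      xor-≡ false true  h = contradiction _ h
      xor-irrefl : ∀ a → ¬ T (a xor a)
      xor-irrefl true  ()
      xor-irrefl false ()
      T-not : ∀ {b} → T (not b) ⇔ (¬ T b)
      T-not {true}  = mk⇔ (λ ()) (λ h → h _)
      T-not {false} = mk⇔ (λ _ ()) _
      neither : ∀ a b → T (not a ∧ not b) → a ≡ false × b ≡ false
      neither false false _ = refl , refl
      isZero⇒ : ∀ i → T (isZero i) → i ≡ 0ℤ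
      isZero⇒ (+ zero) _ = refl
      to : T (decide n L) → S ≡ U ⊎ (Gap K S × ∃ (Flow K S U))
      to t with Equivalence.to (T-∨ {not (any misplaced L)}) t
      ... | inj₁ t₁ = inj₁ (lookup-ext λ u → xor-≡ _ _ λ m → Equivalence.to T-not t₁ (any-trail⁺ misplaced u m))
      ... | inj₂ t₁ with t₂ , t₃ ← Equivalence.to (T-∧ {any uncovered L}) t₁
        with z , s ← Equivalence.to (T-∧ {isZero (total 0ℤ L)}) t₃
        with k , _ , f ← any-downFrom⁻ signed {n} s
        with Equivalence.to (T-∨ {feasible (+ k) L}) f
      ...   | fs = inj₂ (gap , [ flow _ , flow _ ]′ fs)
        where
        flow = λ c → feasible⇒flow c (isZero⇒ _ z)
        gap : Gap K S
        gap = let v , t₄ = any-trail⁻ uncovered t₂ in v , neither _ _ t₄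
      from : S ≡ U ⊎ (Gap K S × ∃ (Flow K S U)) → T (decide n L)
      from (inj₁ refl) = Equivalence.from T-∨ (inj₁ (Equivalence.from (T-not {any misplaced L})
        λ t → let u , x = any-trail⁻ misplaced t in xor-irrefl (lookup S u) x))
      -- The sweep starts with the flow on the closing edge, from `prev v₀` to `v₀`, so that is the
      -- value to be clamped.
      from (inj₂ ((v , p , q) , F)) with flow-clamp₊₋ K F (prev v₀)
      ... | g , k , F′ , k<n , eq = Equivalence.from T-∨ (inj₂ (Equivalence.from T-∧
        ( any-trail⁺ uncovered v (subst₂ (λ a b → T (not a ∧ not b)) (sym p) (sym q) _)
        , Equivalence.from T-∧ ( subst (T ∘ isZero) (sym balance) _
                               , any-downFrom⁺ signed k<n (Equivalence.from T-∨ (feas eq))))))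
        where
        last : g (prev (at n)) ≡ g (prev v₀)
        last = cong (g ∘ prev) (period v₀)
        balance : total 0ℤ L ≡ 0ℤ
        balance = trans
          (cong (λ h → total h L)
            (sym (trans (cong (ℤ._+ (ℤ.- g (prev v₀))) last) (ℤ.+-inverseʳ (g (prev v₀))))))
          (trans (total-flow F′ (ℤ.- g (prev v₀)) n) (ℤ.+-inverseʳ (g (prev v₀))))
        feas′ : T (feasible (g (prev v₀)) L)
        feas′ = subst (λ h → T (feasible h L)) last (feasible-flow F′ n)
        feas : g (prev v₀) ≡ + k ⊎ g (prev v₀) ≡ ℤ.- + k → T (feasible (+ k) L) ⊎ T (feasible (ℤ.- + k) L)
        feas (inj₁ e) = inj₁ (subst (λ h → T (feasible h L)) e feas′)
        feas (inj₂ e) = inj₂ (subst (λ h → T (feasible h L)) e feas′)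

-- A language of polynomial-time loop programs

-- The base `suc n` is never zero, so powers grow with the exponent and adding exponents bounds a
-- sum.
PolyBounded : (ℕ → ℕ) → Set
PolyBounded f = ∃[ K ] ∃[ d ] (∀ n → f n ≤ K * suc n ^ d)

poly-const : ∀ c → PolyBounded (λ _ → c)
poly-const c = c , 0 , λ n → ≤-reflexive (sym (*-identityʳ c))

poly-id : PolyBounded (λ n → n)
poly-id = 1 , 1 , λ n → ≤-trans (n≤1+n n) (≤-reflexive (sym (trans (*-identityˡ _) (*-identityʳ (suc n)))))

poly-+ : ∀ {f g} → PolyBounded f → PolyBounded g → PolyBounded (λ n → f n + g n)
poly-+ {f} {g} (K , d , p) (L , e , q) = K + L , d + e , λ n → begin
  f n + g n                                      ≤⟨ +-mono-≤ (p n) (q n) ⟩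
  K * suc n ^ d + L * suc n ^ e                  ≤⟨ +-mono-≤ (*-monoʳ-≤ K (^-monoʳ-≤ (suc n) (m≤m+n d e)))
                                                             (*-monoʳ-≤ L (^-monoʳ-≤ (suc n) (m≤n+m e d))) ⟩
  K * suc n ^ (d + e) + L * suc n ^ (d + e)      ≡⟨ *-distribʳ-+ (suc n ^ (d + e)) K L ⟨
  (K + L) * suc n ^ (d + e)                      ∎
  where open ≤-Reasoning

poly-* : ∀ {f g} → PolyBounded f → PolyBounded g → PolyBounded (λ n → f n * g n)
poly-* {f} {g} (K , d , p) (L , e , q) = K * L , d + e , λ n → begin
  f n * g n                              ≤⟨ *-mono-≤ (p n) (q n) ⟩
  (K * suc n ^ d) * (L * suc n ^ e)      ≡⟨ [m*n]*[o*p]≡[m*o]*[n*p] K _ L _ ⟩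
  (K * L) * (suc n ^ d * suc n ^ e)      ≡⟨ cong (K * L *_) (^-distribˡ-+-* (suc n) d e) ⟨
  (K * L) * suc n ^ (d + e)              ∎
  where open ≤-Reasoning

-- Each term maps one tree to one tree; several values are passed along by pairing, and `a ⟫ b` runs
-- `b` on the result of `a`.
data Tm : Set where
  inp nil           : Tm
  _,,_              : Tm → Tm → Tm
  hd tl             : Tm → Tm
  if_then_else_     : Tm → Tm → Tm → Tm
  _⟫_               : Tm → Tm → Tm
  rep               : Tm → Tm

infixr 6 _,,_
infixl 5 _⟫_
infix  4 if_then_else_

branch : {A : Set} → Tree → A → A → A
branch nil     x y = y
branch (_ ∙ _) x y = x

⟦_⟧ : Tm → ℕ → Tree → Tree
⟦ inp ⟧                n x = x
⟦ nil ⟧                n x = nil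
⟦ a ,, b ⟧             n x = ⟦ a ⟧ n x ∙ ⟦ b ⟧ n x
⟦ hd a ⟧               n x = head (⟦ a ⟧ n x)
⟦ tl a ⟧               n x = tail (⟦ a ⟧ n x)
⟦ if a then b else c ⟧ n x = branch (⟦ a ⟧ n x) (⟦ b ⟧ n x) (⟦ c ⟧ n x)
⟦ a ⟫ b ⟧              n x = ⟦ b ⟧ n (⟦ a ⟧ n x)
⟦ rep a ⟧              n x = iterate (⟦ a ⟧ n) x n

-- The registers of a compiled term: the current value, a stack, the list
-- whose length is the number of iterations of every loop, and a scratch cell.
pattern val = zero
pattern stk = suc zero
pattern len = suc (suc zero)
pattern tmp = suc (suc (suc zero))

compile : Tm → Cmd 4
compile inp      = val ≔ var val
compile nil      = val ≔ nil
compile (a ,, b) =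
  -- The input is saved on the stack while `a` runs, then exchanged for the result of `a` while `b`
  -- runs on it.
  stk ≔ cons (var val) (var stk) ⨾ compile a ⨾
  tmp ≔ var val ⨾ val ≔ hd (var stk) ⨾ stk ≔ cons (var tmp) (tl (var stk)) ⨾
  compile b ⨾ val ≔ cons (hd (var stk)) (var val) ⨾ stk ≔ tl (var stk)
compile (hd a)   = compile a ⨾ val ≔ hd (var val)
compile (tl a)   = compile a ⨾ val ≔ tl (var val)
compile (if a then b else c) =
  stk ≔ cons (var val) (var stk) ⨾ compile a ⨾
  tmp ≔ var val ⨾ val ≔ hd (var stk) ⨾ stk ≔ tl (var stk) ⨾
  if var tmp then compile b else compile c
compile (a ⟫ b)  = compile a ⨾ compile b
compile (rep a)  =
  -- Each loop counts down its own copy of `len` on the stack, so loops can be nested.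
  stk ≔ cons (var len) (var stk) ⨾
  (while hd (var stk) loop
    (stk ≔ cons (tl (hd (var stk))) (tl (var stk)) ⨾ compile a)) ⨾
  stk ≔ tl (var stk)

spine : Tree → ℕ
spine nil     = 0
spine (_ ∙ t) = suc (spine t)

infix 3 ⟨_,_⟩⇓≤[_]_

⟨_,_⟩⇓≤[_]_ : ∀ {k} → Cmd k → Store k → ℕ → Store k → Set
⟨ c , σ ⟩⇓≤[ m ] σ′ = ∃[ t ] (⟨ c , σ ⟩⇓[ t ] σ′ × t ≤ m)

module _ {k : ℕ} where
  private
    variable
      c d      : Cmd k
      e        : Expr k
      σ σ′ σ″  : Store k
      m m′     : ℕ

  assign≤ : ∀ {x} → ⟨ x ≔ e , σ ⟩⇓≤[ suc (cost e) ] (σ [ x ]≔ eval e σ)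
  assign≤ = _ , assign , ≤-refl

  infixr 4 _⨾≤_
  _⨾≤_ : ⟨ c , σ ⟩⇓≤[ m ] σ′ → ⟨ d , σ′ ⟩⇓≤[ m′ ] σ″ → ⟨ c ⨾ d , σ ⟩⇓≤[ suc (m + m′) ] σ″
  (_ , p , s≤) ⨾≤ (_ , q , t≤) = _ , seq p q , s≤s (+-mono-≤ s≤ t≤)

  weaken≤ : m ≤ m′ → ⟨ c , σ ⟩⇓≤[ m ] σ′ → ⟨ c , σ ⟩⇓≤[ m′ ] σ′
  weaken≤ m≤m′ (_ , p , s≤) = _ , p , ≤-trans s≤ m≤m′

  ifTrue≤ : ∀ {a b} → eval e σ ≡ a ∙ b → ⟨ c , σ ⟩⇓≤[ m ] σ′ →
            ⟨ if e then c else d , σ ⟩⇓≤[ suc (cost e + m) ] σ′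
  ifTrue≤ {e = e} eq (_ , p , s≤) = _ , ifTrue eq p , s≤s (+-monoʳ-≤ (cost e) s≤)

  ifFalse≤ : eval e σ ≡ nil → ⟨ d , σ ⟩⇓≤[ m ] σ′ →
             ⟨ if e then c else d , σ ⟩⇓≤[ suc (cost e + m) ] σ′
  ifFalse≤ {e = e} eq (_ , p , s≤) = _ , ifFalse eq p , s≤s (+-monoʳ-≤ (cost e) s≤)

  whileTrue≤ : ∀ {a b} → eval e σ ≡ a ∙ b → ⟨ c , σ ⟩⇓≤[ m ] σ′ →
               ⟨ while e loop c , σ′ ⟩⇓≤[ m′ ] σ″ →
               ⟨ while e loop c , σ ⟩⇓≤[ suc (cost e + m + m′) ] σ″
  whileTrue≤ {e = e} eq (_ , p , s≤) (_ , q , t≤) =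
    _ , whileTrue eq p q , s≤s (+-mono-≤ (+-monoʳ-≤ (cost e) s≤) t≤)

  whileStop≤ : eval e σ ≡ nil → ⟨ while e loop c , σ ⟩⇓≤[ suc (cost e) ] σ
  whileStop≤ eq = _ , whileStop eq , ≤-refl

-- Stack and `len` come back unchanged, while the scratch cell may hold anything. The bound depends
-- on the loop count alone, as unit costs ignore the sizes of trees.
Runs : Cmd 4 → (ℕ → Tree → Tree) → (ℕ → ℕ) → Set
Runs c F f = ∀ x s N y → ∃[ y′ ]
  (⟨ c , x ∷ s ∷ N ∷ y ∷ [] ⟩⇓≤[ f (spine N) ] (F (spine N) x ∷ s ∷ N ∷ y′ ∷ []))

-- A round costs 1 + 2 for the loop and its test, 7 for shortening the counter and 1 for sequencing,
-- besides the body; the final test costs 3.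
runs-loop : ∀ {f c F} → Runs c F f → ∀ M x s N y → ∃[ y′ ]
  (⟨ while hd (var stk) loop (stk ≔ cons (tl (hd (var stk))) (tl (var stk)) ⨾ c)
   , x ∷ (M ∙ s) ∷ N ∷ y ∷ [] ⟩⇓≤[ spine M * (11 + f (spine N)) + 3 ]
   (iterate (F (spine N)) x (spine M) ∷ (nil ∙ s) ∷ N ∷ y′ ∷ []))
runs-loop r nil     x s N y = y , whileStop≤ refl
runs-loop {f} {F = F} r (_ ∙ M) x s N y =
  let y₁ , p = r x (M ∙ s) N y
      y₂ , q = runs-loop {f} {F = F} r M _ s N y₁
  in  y₂ , weaken≤ (≤-reflexive (sym (+-assoc (11 + f (spine N)) _ 3)))
                   (whileTrue≤ refl (assign≤ ⨾≤ p) q)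

runs-compile : ∀ t → ∃[ f ] (PolyBounded f × Runs (compile t) ⟦ t ⟧ f)
runs-compile inp = _ , poly-const _ , λ x s N y → _ , assign≤
runs-compile nil = _ , poly-const _ , λ x s N y → _ , assign≤
runs-compile (a ,, b) =
  let f , pf , ra = runs-compile a
      g , pg , rb = runs-compile b
  -- The constants count the assignments and sequencing between subterms. The sum is nested like the
  -- command, so the bound matches definitionally.
  in  _ , poly-+ (poly-const 6) (poly-+ pf (poly-+ (poly-const 14) (poly-+ pg (poly-const 9)))) , λ x s N y →
      let y₁ , p = ra x (x ∙ s) N y
          y₂ , q = rb x (⟦ a ⟧ (spine N) x ∙ s) N (⟦ a ⟧ (spine N) x)
      in  y₂ , (assign≤ ⨾≤ p ⨾≤ assign≤ ⨾≤ assign≤ ⨾≤ assign≤ ⨾≤ q ⨾≤ assign≤ ⨾≤ assign≤)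
runs-compile (hd a) =
  let f , pf , r = runs-compile a
  in  _ , poly-+ (poly-const 1) (poly-+ pf (poly-const 3)) , λ x s N y →
      let y₁ , p = r x s N y in y₁ , (p ⨾≤ assign≤)
runs-compile (tl a) =
  let f , pf , r = runs-compile a
  in  _ , poly-+ (poly-const 1) (poly-+ pf (poly-const 3)) , λ x s N y →
      let y₁ , p = r x s N y in y₁ , (p ⨾≤ assign≤)
runs-compile (if a then b else c) =
  let f , pf , ra = runs-compile a
      g , pg , rb = runs-compile b
      h , ph , rc = runs-compile c
  in  _ , poly-+ (poly-const 6) (poly-+ pf (poly-+ (poly-const 13) (poly-+ pg ph))) , λ x s N y →
      let y₁ , p = ra x (x ∙ s) N y
          y₂ , q = runs-branch {g} {h} rb rc x s N (⟦ a ⟧ (spine N) x)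
      in  y₂ , (assign≤ ⨾≤ p ⨾≤ assign≤ ⨾≤ assign≤ ⨾≤ assign≤ ⨾≤ q)
  where
  -- The sum of the two bounds stands in for their maximum.
  runs-branch : ∀ {g h} → Runs (compile b) ⟦ b ⟧ g → Runs (compile c) ⟦ c ⟧ h → ∀ x s N v → ∃[ y ]
    (⟨ if var tmp then compile b else compile c , x ∷ s ∷ N ∷ v ∷ [] ⟩⇓≤[ 2 + (g (spine N) + h (spine N)) ]
     (branch v (⟦ b ⟧ (spine N) x) (⟦ c ⟧ (spine N) x) ∷ s ∷ N ∷ y ∷ []))
  runs-branch {g} {h} rb rc x s N nil =
    let y , p = rc x s N nil
    in  y , ifFalse≤ refl (weaken≤ (m≤n+m (h (spine N)) (g (spine N))) p)
  runs-branch {g} {h} rb rc x s N v@(_ ∙ _) =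
    let y , p = rb x s N v
    in  y , ifTrue≤ refl (weaken≤ (m≤m+n (g (spine N)) (h (spine N))) p)
runs-compile (a ⟫ b) =
  let f , pf , ra = runs-compile a
      g , pg , rb = runs-compile b
  in  _ , poly-+ (poly-const 1) (poly-+ pf pg) , λ x s N y →
      let y₁ , p = ra x s N y
          y₂ , q = rb _ s N y₁
      in  y₂ , (p ⨾≤ q)
runs-compile (rep a) =
  let f , pf , r = runs-compile a
  in  _ , poly-+ (poly-const 6)
            (poly-+ (poly-+ (poly-* poly-id (poly-+ (poly-const 11) pf)) (poly-const 3)) (poly-const 3)) ,
      λ x s N y →
      let y₁ , p = runs-loop {f} {F = ⟦ a ⟧} r N x s N y
      in  y₁ , (assign≤ ⨾≤ p ⨾≤ assign≤)

-- The second component of an encoded instance lists the source set, so its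
-- spine has as many cells as the graph has vertices.
program : Tm → Program
program t = record { auxVars = 3 ; body = len ≔ hd (tl (var val)) ⨾ compile t }

program-runs : ∀ t → ∃[ c ] ∃[ k ] (∀ A S T →
  program t on A ∙ S ∙ T returns ⟦ t ⟧ (spine S) (A ∙ S ∙ T) within (c * size (A ∙ S ∙ T) ^ k + c))
program-runs t with runs-compile t
-- Setting `len` costs 4 and sequencing 1. The same constant has to serve as factor and as summand.
... | f , (K , d , f≤) , r = 5 + K , d , λ A S T →
  let x = A ∙ S ∙ T
      y , s , p , s≤ = r x nil S nil
  in  _ , _ , seq assign p , (begin
        5 + s                              ≤⟨ +-monoʳ-≤ 5 s≤ ⟩
        5 + f (spine S)                    ≤⟨ +-monoʳ-≤ 5 (f≤ (spine S)) ⟩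
        5 + K * suc (spine S) ^ d          ≤⟨ +-monoʳ-≤ 5 (*-mono-≤ (m≤n+m K 5) (^-monoˡ-≤ d (spine<size A S T))) ⟩
        5 + (5 + K) * size x ^ d           ≤⟨ +-monoˡ-≤ _ (m≤m+n 5 K) ⟩
        (5 + K) + (5 + K) * size x ^ d     ≡⟨ +-comm (5 + K) _ ⟩
        (5 + K) * size x ^ d + (5 + K)     ∎)
  where
  open ≤-Reasoning
  spine<size : ∀ A S T → spine S < size (A ∙ S ∙ T)
  spine<size A S T = s≤s (begin
    spine S                            ≤⟨ spine≤size S ⟩
    size S                             ≤⟨ m≤m+n (size S) (size T) ⟩
    size S + size T                    ≤⟨ n≤1+n _ ⟩
    size (S ∙ T)                       ≤⟨ m≤n+m _ (size A) ⟩
    size A + size (S ∙ T)              ∎)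
    where
    spine≤size : ∀ t → spine t ≤ size t
    spine≤size nil     = z≤n
    spine≤size (a ∙ t) = s≤s (≤-trans (spine≤size t) (m≤n+m (size t) (size a)))

-- The algorithm as a term

truth : Tree → Bool
truth nil     = false
truth (_ ∙ _) = true

truth-encodeBool : ∀ b → truth (encodeBool b) ≡ b
truth-encodeBool true  = refl
truth-encodeBool false = refl

branch-∨ : ∀ {t a} b → truth t ≡ a → branch t (nil ∙ nil) (encodeBool b) ≡ encodeBool (a ∨ b)
branch-∨ {nil}   _ refl = refl
branch-∨ {_ ∙ _} _ refl = refl

branch-∧ : ∀ {t a} b → truth t ≡ a → branch t (encodeBool b) nil ≡ encodeBool (a ∧ b)
branch-∧ {nil}   _ refl = refl
branch-∧ {_ ∙ _} _ refl = refl

yesᵗ : Tm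
yesᵗ = nil ,, nil

unary : ℕ → Tree
unary zero    = nil
unary (suc k) = nil ∙ unary k

-- Loops have the fixed length `n`, so the rounds left after the counter runs out are idle; this is
-- why indices must not exceed `n`.
dropᵗ : Tm
dropᵗ = rep (if hd inp then tl (hd inp) ,, tl (tl inp) else inp) ⟫ tl inp

drop-correct : ∀ {n i} l → i ≤ n → ⟦ dropᵗ ⟧ n (unary i ∙ l) ≡ iterate tail l i
drop-correct {n} l i≤n = cong tail (go n _ l i≤n)
  where
  pass = ⟦ if hd inp then tl (hd inp) ,, tl (tl inp) else inp ⟧ n
  go : ∀ m i l → i ≤ m → iterate pass (unary i ∙ l) m ≡ nil ∙ iterate tail l i
  go zero    zero    l _         = refl
  go (suc m) zero    l _         = go m zero l z≤n
  go (suc m) (suc i) l (s≤s i≤m) = go m i (tail l) i≤m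

getᵗ : Tm
getᵗ = dropᵗ ⟫ hd inp

get-correct : ∀ {A : Set} {n} (f : A → Tree) (v : Vec A n) i →
              ⟦ getᵗ ⟧ n (unary (toℕ i) ∙ encodeVec f v) ≡ f (lookup v i)
get-correct f v i = trans (cong head (drop-correct (encodeVec f v) (<⇒≤ (toℕ<n i)))) (go v i)
  where
  go : ∀ {n} (v : Vec _ n) i → head (iterate tail (encodeVec f v) (toℕ i)) ≡ f (lookup v i)
  go (_ ∷ _) zero    = refl
  go (_ ∷ v) (suc i) = go v i

-- Truncated subtraction both ways: two numbers differ exactly when one of the differences is
-- nonzero.
apartᵗ : Tm
apartᵗ = if dropᵗ then yesᵗ else ((tl inp ,, hd inp) ⟫ dropᵗ)

apart-correct : ∀ {n i j} → i ≤ n → j ≤ n → T (truth (⟦ apartᵗ ⟧ n (unary i ∙ unary j))) ⇔ (i ≢ j)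
apart-correct {n} {i} {j} i≤n j≤n
  rewrite drop-correct {n} (unary j) i≤n | drop-correct {n} (unary i) j≤n = go i j
  where
  tail-nil : ∀ i → iterate tail nil i ≡ nil
  tail-nil zero    = refl
  tail-nil (suc i) = tail-nil i
  go : ∀ i j → T (truth (branch (iterate tail (unary j) i) (nil ∙ nil) (iterate tail (unary i) j))) ⇔ (i ≢ j)
  go zero    zero    = mk⇔ (λ ()) (λ ne → ne refl)
  go zero    (suc j) = mk⇔ (λ _ ()) _
  go (suc i) zero    rewrite tail-nil i = mk⇔ (λ _ ()) _
  go (suc i) (suc j) = mk⇔ (λ t → Equivalence.to (go i j) t ∘ suc-injective)
                           (λ ne → Equivalence.from (go i j) (ne ∘ cong suc))

arcᵗ adjacentᵗ : Tm
arcᵗ = (hd (tl inp) ,, ((hd inp ,, tl (tl inp)) ⟫ getᵗ)) ⟫ getᵗ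
adjacentᵗ = if arcᵗ then yesᵗ else ((hd (tl inp) ,, hd inp ,, tl (tl inp)) ⟫ arcᵗ)

-- The loop keeps the last vertex adjacent to cur and different from prv.
findᵗ : Tm
findᵗ = (inp ,, nil ,, nil) ⟫ rep
  (let A = hd (hd inp) ; cur = hd (tl (hd inp)) ; prv = tl (tl (hd inp)) ; v = hd (tl inp) in
   hd inp ,, (nil ,, v) ,,
   (if (if (cur ,, v ,, A) ⟫ adjacentᵗ then (v ,, prv) ⟫ apartᵗ else nil) then v else tl (tl inp)))
  ⟫ tl (tl inp)

module _ (G : OrientedGraph) where
  private
    V = Fin (order G)
    n = order G

  vertex : V → Tree
  vertex u = unary (toℕ u)

  arc-correct : ∀ u v → ⟦ arcᵗ ⟧ n (vertex u ∙ vertex v ∙ encodeGraph G) ≡ encodeBool (arc G u v)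
  arc-correct u v
    rewrite get-correct (encodeVec encodeBool) (tabulate (λ u → tabulate (λ v → arc G u v))) u
          | lookup∘tabulate (λ u → tabulate (λ v → arc G u v)) u
          | get-correct encodeBool (tabulate (λ v → arc G u v)) v
          = cong encodeBool (lookup∘tabulate _ v)

  adjacent-correct : ∀ u v → ⟦ adjacentᵗ ⟧ n (vertex u ∙ vertex v ∙ encodeGraph G) 
                           ≡ encodeBool (arc G u v ∨ arc G v u)
  adjacent-correct u v rewrite arc-correct v u =
    branch-∨ (arc G v u) (trans (cong truth (arc-correct u v)) (truth-encodeBool _))

  -- Which admissible vertex is found does not matter: at the start either neighbour will do, and
  -- later the excluded predecessor leaves only one.
  find-correct : ∀ u p → (∃[ v ] (Und G u v × v ≢ p)) →
                 ∃[ v ] (Und G u v × v ≢ p × ⟦ findᵗ ⟧ n (encodeGraph G ∙ vertex u ∙ vertex p) ≡ vertex v)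
  find-correct u p (w , adj , w≢p) =
    let m , m<n , eq , t = scan n (toℕ w , toℕ<n w , Equivalence.from (admissible w) (adj , w≢p))
        v                = fromℕ< m<n
        m≡v              = sym (toℕ-fromℕ< m<n)
        adj′ , v≢p       = Equivalence.to (admissible v) (subst (T ∘ test) m≡v t)
    in  v , adj′ , v≢p , trans (cong (tail ∘ tail) (trans (sym (iterate-is-fold _ pass n)) (state n)))
                               (trans eq (cong unary m≡v))
    where
    ρ = encodeGraph G ∙ vertex u ∙ vertex p
    cond : ℕ → Tree
    cond v = branch (⟦ adjacentᵗ ⟧ n (vertex u ∙ unary v ∙ encodeGraph G)) (⟦ apartᵗ ⟧ n (unary v ∙ vertex p)) nil
    test : ℕ → Bool
    test = truth ∘ cond
    pass : Tree → Tree
    pass s = head s ∙ (nil ∙ head (tail s)) ∙ branch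
      (branch (⟦ adjacentᵗ ⟧ n (head (tail (head s)) ∙ head (tail s) ∙ head (head s)))
        (⟦ apartᵗ ⟧ n (head (tail s) ∙ tail (tail (head s)))) nil) (head (tail s)) (tail (tail s))
    found : ℕ → Tree
    found zero    = nil
    found (suc m) = branch (cond m) (unary m) (found m)
    state : ∀ m → fold (ρ ∙ nil ∙ nil) pass m ≡ ρ ∙ unary m ∙ found m
    state zero    = refl
    state (suc m) = cong pass (state m)
    scan : ∀ m → (∃[ v ] (v < m × T (test v))) → ∃[ v ] (v < m × found m ≡ unary v × T (test v))
    scan (suc m) (v , s≤s v≤m , t) with cond m in eq
    ... | _ ∙ _ = m , ≤-refl , refl , subst (T ∘ truth) (sym eq) _
    ... | nil with v ≟ m
    ...   | yes refl = contradiction (subst (T ∘ truth) eq t) λ ()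
    ...   | no v≢m   = let w , w<m , eq′ , t′ = scan m (v , ≤∧≢⇒< v≤m v≢m , t) 
                    in  w , <-trans w<m ≤-refl , eq′ , t′
    admissible : ∀ v → T (test (toℕ v)) ⇔ (Und G u v × v ≢ p)
    admissible v rewrite adjacent-correct u v
      with arc G u v | arc G v u | apart-correct {n} {toℕ v} {toℕ p} (<⇒≤ (toℕ<n v)) (<⇒≤ (toℕ<n p))
    ... | true  | _     | ap = mk⇔ (λ t → inj₁ _ , λ { refl → Equivalence.to ap t refl })
                                   (λ (_ , ne) → Equivalence.from ap (ne ∘ toℕ-injective))
    ... | false | true  | ap = mk⇔ (λ t → inj₂ _ , λ { refl → Equivalence.to ap t refl })
                                   (λ (_ , ne) → Equivalence.from ap (ne ∘ toℕ-injective))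
    ... | false | false | ap = mk⇔ (λ ()) λ { (inj₁ () , _) ; (inj₂ () , _) }

-- Walking round the cycle

encodeEntry : Entry → Tree
encodeEntry (entry s s′ t d) = encodeBool s ∙ encodeBool s′ ∙ encodeBool t ∙ encodeBool d

encodeEntries : List Entry → Tree
encodeEntries = encodeList ∘ map encodeEntry

-- The state is `I ∙ prv ∙ cur ∙ L` with `I` the instance. Initially both vertices are `nil`, the
-- unary zero, so the first search excludes only the starting vertex itself.
stepᵗ recordᵗ walkᵗ : Tm
stepᵗ = let A = hd (hd inp) ; prv = hd (tl inp) ; cur = hd (tl (tl inp)) in
  inp ,, ((A ,, cur ,, prv) ⟫ findᵗ)
recordᵗ =
  let I = hd (hd inp) ; A = hd I ; S = hd (tl I) ; U = tl (tl I)
      cur = hd (tl (tl (hd inp))) ; nxt = tl inp ; L = tl (tl (tl (hd inp))) in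
  I ,, cur ,, nxt ,,
  ((((cur ,, S) ⟫ getᵗ) ,, ((nxt ,, S) ⟫ getᵗ) ,, ((cur ,, U) ⟫ getᵗ) ,, ((cur ,, nxt ,, A) ⟫ arcᵗ)) ,, L)
walkᵗ = (inp ,, nil ,, nil ,, nil) ⟫ rep (stepᵗ ⟫ recordᵗ) ⟫ tl (tl (tl inp))

module _ (x : Instance) (K : CyclicOrder (graph x)) where
  private
    G = graph x
    n = order G
    V = Fin n
  open CyclicOrder K

  module _ (v₀ : V) (v₀≡0 : toℕ v₀ ≡ 0)
           (start : ⟦ findᵗ ⟧ n (encodeGraph G ∙ vertex G v₀ ∙ vertex G v₀) ≡ vertex G (next v₀)) where
    open Trail {G} {source x} {target x} K v₀

    back : ℕ → V
    back zero    = v₀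
    back (suc j) = at j

    -- The neighbour behind `at (suc j)` is `at j`, which the search excludes; `next²≢id` guarantees
    -- that the other one remains.
    find-next : ∀ j → ⟦ findᵗ ⟧ n (encodeGraph G ∙ vertex G (at j) ∙ vertex G (back j)) ≡ vertex G (next (at j))
    find-next zero    = start
    find-next (suc j) with v , e , v≢ , eq ← find-correct G (at (suc j)) (at j)
                             (_ , edge (at (suc j)) , next²≢id (at j)) | edge⁻¹ _ _ e
    ... | inj₁ v≡ = trans eq (cong (vertex G) v≡)
    ... | inj₂ v≡ = contradiction (trans v≡ (prev-next (at j))) v≢

    record-correct : ∀ p u L → ⟦ recordᵗ ⟧ n ((encode x ∙ p ∙ vertex G u ∙ L) ∙ vertex G (next u))
                   ≡ encode x ∙ vertex G u ∙ vertex G (next u) ∙ encodeEntry (entryAt u) ∙ L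
    record-correct p u L = cong (λ e → encode x ∙ vertex G u ∙ vertex G (next u) ∙ e ∙ L)
      (cong₂ _∙_ (get-correct encodeBool (source x) u) (cong₂ _∙_ (get-correct encodeBool (source x) (next u))
        (cong₂ _∙_ (get-correct encodeBool (target x) u) (arc-correct G u (next u)))))

    walk-state : ∀ j → fold (encode x ∙ nil ∙ nil ∙ nil) (⟦ stepᵗ ⟫ recordᵗ ⟧ n) j
               ≡ encode x ∙ vertex G (back j) ∙ vertex G (at j) ∙ encodeEntries (trail j)
    walk-state zero    = cong₂ (λ p c → encode x ∙ p ∙ c ∙ nil) zero-vertex zero-vertex
      where
      zero-vertex : nil ≡ vertex G v₀
      zero-vertex = cong unary (sym v₀≡0)
    walk-state (suc j) = trans (cong (⟦ stepᵗ ⟫ recordᵗ ⟧ n) (walk-state j))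
      (trans (cong (λ t → ⟦ recordᵗ ⟧ n ((encode x ∙ vertex G (back j) ∙ vertex G (at j) ∙ encodeEntries (trail j)) ∙ t))
                (find-next j))
             (record-correct (vertex G (back j)) (at j) (encodeEntries (trail j))))

    walk-from-correct : ⟦ walkᵗ ⟧ n (encode x) ≡ encodeEntries (trail n)
    walk-from-correct = cong (λ s → tail (tail (tail s)))
      (trans (sym (iterate-is-fold (encode x ∙ nil ∙ nil ∙ nil) (⟦ stepᵗ ⟫ recordᵗ ⟧ n) n)) (walk-state n))

-- The first search decides the direction. If it returns `prev v₀`, the walk follows `mirror K`;
-- hence the existential order in the conclusion.
walk-correct : ∀ x → CyclicOrder (graph x) → let G = graph x in
  Σ[ K ∈ CyclicOrder G ] ∃[ v₀ ] ⟦ walkᵗ ⟧ (order G) (encode x)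
    ≡ encodeEntries (Trail.trail {G} {source x} {target x} K v₀ (order G))
walk-correct x K =
  let v₁ , e , _ , eq = find-correct G v₀ v₀ (_ , edge v₀ , next≢id {G} K v₀) in
  [ (λ v₁≡ → K        , v₀ , walk-from-correct x K          v₀ v₀≡0 (trans eq (cong (vertex G) v₁≡)))
  , (λ v₁≡ → mirror K , v₀ , walk-from-correct x (mirror K) v₀ v₀≡0 (trans eq (cong (vertex G) v₁≡)))
  ]′ (edge⁻¹ v₀ v₁ e)
  where
  open CyclicOrder K
  G = graph x
  0<n = ≤-trans (s≤s z≤n) 3≤order
  v₀ = fromℕ< 0<n
  v₀≡0 = toℕ-fromℕ< 0<n

-- Evaluating the criterion on a trail

misplacedᵗ uncoveredᵗ : Tm
misplacedᵗ = let s = hd inp ; t = hd (tl (tl inp)) in if s then (if t then nil else yesᵗ) else t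
uncoveredᵗ = let s = hd inp ; s′ = hd (tl inp) in if s then nil else (if s′ then nil else yesᵗ)

misplaced-correct : ∀ n e → ⟦ misplacedᵗ ⟧ n (encodeEntry e) ≡ encodeBool (misplaced e)
misplaced-correct n (entry true  _ true  _) = refl
misplaced-correct n (entry true  _ false _) = refl
misplaced-correct n (entry false _ _     _) = refl

uncovered-correct : ∀ n e → ⟦ uncoveredᵗ ⟧ n (encodeEntry e) ≡ encodeBool (uncovered e)
uncovered-correct n (entry true  _     _ _) = refl
uncovered-correct n (entry false true  _ _) = refl
uncovered-correct n (entry false false _ _) = refl

anyᵗ : Tm → Tm
anyᵗ p = (inp ,, nil) ⟫ rep (tl (hd inp) ,, (if hd (hd inp) ⟫ p then yesᵗ else tl inp)) ⟫ tl inp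

any-correct : ∀ p q → (∀ n e → ⟦ p ⟧ n (encodeEntry e) ≡ encodeBool (q e)) →
              ∀ L → ⟦ anyᵗ p ⟧ (length L) (encodeEntries L) ≡ encodeBool (any q L)
any-correct p q p≡q L = cong tail (trans (go L false) (cong (λ b → nil ∙ encodeBool b) (∨-identityʳ _)))
  where
  go : ∀ M r → iterate (⟦ tl (hd inp) ,, (if hd (hd inp) ⟫ p then yesᵗ else tl inp) ⟧ (length L))
                 (encodeEntries M ∙ encodeBool r) (length M) ≡ nil ∙ encodeBool (any q M ∨ r)
  go []      r = refl
  go (e ∷ M) r
    rewrite branch-∨ r (trans (cong truth (p≡q (length L) e)) (truth-encodeBool (q e)))
    = trans (go M (q e ∨ r)) (cong (λ b → nil ∙ encodeBool b)
        (trans (sym (∨-assoc (any q M) (q e) r)) (cong (_∨ r) (∨-comm (any q M) (q e)))))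

-- Positive and negative part in unary, at most one of them nonzero, so that sign tests are
-- comparisons with `nil`.
encodeℤ : ℤ → Tree
encodeℤ (+ k)      = unary k ∙ nil
encodeℤ (-[1+ k ]) = nil ∙ unary (suc k)

sucᵗ predᵗ : Tm
sucᵗ  = if tl inp then hd inp ,, tl (tl inp) else (nil ,, hd inp) ,, nil
predᵗ = if hd inp then tl (hd inp) ,, tl inp else nil ,, nil ,, tl inp

suc-correct : ∀ {n} i → ⟦ sucᵗ ⟧ n (encodeℤ i) ≡ encodeℤ (ℤ.suc i)
suc-correct (+ k)          = refl
suc-correct -[1+ zero ]    = refl
suc-correct -[1+ suc k ]   = refl

pred-correct : ∀ {n} i → ⟦ predᵗ ⟧ n (encodeℤ i) ≡ encodeℤ (ℤ.pred i)
pred-correct (+ zero)      = refl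
pred-correct (+ suc k)     = refl
pred-correct -[1+ k ]      = refl

beforeᵗ allowedᵗ : Tm
beforeᵗ  = (hd inp ,, (if hd (hd inp) then tl inp ⟫ predᵗ else tl inp)) ⟫
           (if hd (tl (tl (hd inp))) then tl inp ⟫ sucᵗ else tl inp)
allowedᵗ = if tl (tl (tl (hd inp))) 
           then (if tl (tl inp) then nil else yesᵗ)
           else (if hd (tl inp) then nil else yesᵗ)

before-correct : ∀ {n} e h → ⟦ beforeᵗ ⟧ n (encodeEntry e ∙ encodeℤ h) ≡ encodeℤ (before e h)
before-correct {n} (entry true  s′ true  d) h rewrite pred-correct {n} h | suc-correct {n} (ℤ.pred h) =
  cong encodeℤ (trans (ℤ.+-comm 1ℤ (ℤ.pred h)) (cong (ℤ._+ 1ℤ) (ℤ.+-comm ℤ.-1ℤ h)))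
before-correct {n} (entry true  s′ false d) h rewrite pred-correct {n} h =
  cong encodeℤ (trans (ℤ.+-comm ℤ.-1ℤ h) (sym (ℤ.+-identityʳ _)))
before-correct {n} (entry false s′ true  d) h rewrite suc-correct {n} h =
  cong encodeℤ (trans (ℤ.+-comm 1ℤ h) (cong (ℤ._+ 1ℤ) (sym (ℤ.+-identityʳ h))))
before-correct {n} (entry false s′ false d) h =
  cong encodeℤ (sym (trans (ℤ.+-identityʳ _) (ℤ.+-identityʳ h)))

allowed-correct : ∀ {n} e h → ⟦ allowedᵗ ⟧ n (encodeEntry e ∙ encodeℤ h) ≡ encodeBool (allowed e h)
allowed-correct (entry _ _ _ true)  (+ _)     = refl
allowed-correct (entry _ _ _ true)  -[1+ _ ]  = refl
allowed-correct (entry _ _ _ false) (+ zero)  = refl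
allowed-correct (entry _ _ _ false) (+ suc _) = refl
allowed-correct (entry _ _ _ false) -[1+ _ ]  = refl

-- One pass computes `total` and `feasible` together; `balancedᵗ` reads the first and `searchᵗ` the
-- second.
sweepᵗ : Tm
sweepᵗ = (tl inp ,, hd inp ,, yesᵗ) ⟫ rep
  (let e = hd (hd inp) ; h = hd (tl inp) in
   tl (hd inp) ,, ((e ,, h) ⟫ beforeᵗ) ,, (if (e ,, h) ⟫ allowedᵗ then tl (tl inp) else nil))
  ⟫ tl inp

sweep-correct : ∀ h L → ⟦ sweepᵗ ⟧ (length L) (encodeℤ h ∙ encodeEntries L)
                      ≡ encodeℤ (total h L) ∙ encodeBool (feasible h L)
sweep-correct h L = cong tail (go L h true)
  where
  pass : Tree → Tree
  pass s = tail (head s) ∙ ⟦ beforeᵗ ⟧ (length L) (head (head s) ∙ head (tail s)) ∙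
    branch (⟦ allowedᵗ ⟧ (length L) (head (head s) ∙ head (tail s))) (tail (tail s)) nil
  go : ∀ M h ok → iterate pass (encodeEntries M ∙ encodeℤ h ∙ encodeBool ok) (length M)
                ≡ nil ∙ encodeℤ (total h M) ∙ encodeBool (ok ∧ feasible h M)
  go []      h ok = cong (λ b → nil ∙ encodeℤ h ∙ encodeBool b) (sym (∧-identityʳ ok))
  go (e ∷ M) h ok
    rewrite before-correct {length L} e h
          | branch-∧ ok (trans (cong truth (allowed-correct {length L} e h)) (truth-encodeBool (allowed e h)))
    = trans (go M (before e h) (allowed e h ∧ ok)) (cong (λ b → nil ∙ encodeℤ (total h (e ∷ M)) ∙ encodeBool b)
        (trans (cong (_∧ feasible (before e h) M) (∧-comm (allowed e h) ok)) (∧-assoc ok (allowed e h) _)))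

-- The round counter `k` is also the candidate constant: `k ,, nil` and `nil ,, k` encode `+ k` and
-- its negative.
searchᵗ : Tm
searchᵗ = (inp ,, nil ,, nil) ⟫ rep
  (let L = hd inp ; k = hd (tl inp) in
   L ,, (nil ,, k) ,,
   (if ((k ,, nil) ,, L) ⟫ sweepᵗ ⟫ tl inp then yesᵗ else
    (if ((nil ,, k) ,, L) ⟫ sweepᵗ ⟫ tl inp then yesᵗ else tl (tl inp))))
  ⟫ tl (tl inp)

search-correct : ∀ L → ⟦ searchᵗ ⟧ (length L) (encodeEntries L)
  ≡ encodeBool (any (λ k → feasible (+ k) L ∨ feasible (ℤ.- + k) L) (downFrom (length L)))
search-correct L = cong (tail ∘ tail) (trans (sym (iterate-is-fold _ pass (length L))) (state (length L)))
  where
  pass : Tree → Tree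
  pass s = head s ∙ (nil ∙ head (tail s)) ∙
    branch (tail (⟦ sweepᵗ ⟧ (length L) ((head (tail s) ∙ nil) ∙ head s))) (nil ∙ nil)
      (branch (tail (⟦ sweepᵗ ⟧ (length L) ((nil ∙ head (tail s)) ∙ head s))) (nil ∙ nil) (tail (tail s)))
  encodeℤ-neg : ∀ k → nil ∙ unary k ≡ encodeℤ (ℤ.- + k)
  encodeℤ-neg zero    = refl
  encodeℤ-neg (suc k) = refl
  state : ∀ m → fold (encodeEntries L ∙ nil ∙ nil) pass m
    ≡ encodeEntries L ∙ unary m ∙ encodeBool (any (λ k → feasible (+ k) L ∨ feasible (ℤ.- + k) L) (downFrom m))
  state zero    = refl
  state (suc m) rewrite state m
    | branch-∨ (any (λ k → feasible (+ k) L ∨ feasible (ℤ.- + k) L) (downFrom m))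
        (trans (cong (truth ∘ tail)
                 (trans (cong (λ t → ⟦ sweepᵗ ⟧ (length L) (t ∙ encodeEntries L)) (encodeℤ-neg m))
                        (sweep-correct (ℤ.- + m) L)))
               (truth-encodeBool (feasible (ℤ.- + m) L)))
    | branch-∨ (feasible (ℤ.- + m) L ∨ any (λ k → feasible (+ k) L ∨ feasible (ℤ.- + k) L) (downFrom m))
        (trans (cong (truth ∘ tail) (sweep-correct (+ m) L)) (truth-encodeBool (feasible (+ m) L)))
    = cong (λ b → encodeEntries L ∙ unary (suc m) ∙ encodeBool b) (sym (∨-assoc (feasible (+ m) L) _ _))

balancedᵗ decideᵗ : Tm
balancedᵗ = ((nil ,, nil) ,, inp) ⟫ sweepᵗ ⟫ hd inp ⟫ (if hd inp then nil else (if tl inp then nil else yesᵗ))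
decideᵗ   = if anyᵗ misplacedᵗ
            then (if anyᵗ uncoveredᵗ then (if balancedᵗ then searchᵗ else nil) else nil)
            else yesᵗ

balanced-correct : ∀ L → ⟦ balancedᵗ ⟧ (length L) (encodeEntries L) ≡ encodeBool (isZero (total 0ℤ L))
balanced-correct L rewrite sweep-correct 0ℤ L with total 0ℤ L
... | + zero   = refl
... | + suc _  = refl
... | -[1+ _ ] = refl

decideᵗ-correct : ∀ L → ⟦ decideᵗ ⟧ (length L) (encodeEntries L) ≡ encodeBool (decide (length L) L)
decideᵗ-correct L
  rewrite any-correct misplacedᵗ misplaced misplaced-correct L
        | any-correct uncoveredᵗ uncovered uncovered-correct L
        | balanced-correct L | search-correct L
  with any misplaced L | any uncovered L | isZero (total 0ℤ L)
... | false | _     | _     = refl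
... | true  | false | _     = refl
... | true  | true  | false = refl
... | true  | true  | true  = refl

-- Assembling the decision procedure

spine-encodeVec : ∀ {A : Set} {n} (f : A → Tree) (v : Vec A n) → spine (encodeVec f v) ≡ n
spine-encodeVec f []      = refl
spine-encodeVec f (_ ∷ v) = cong suc (spine-encodeVec f v)

term-decides : ∀ {Dom Yes : Instance → Set} (t : Tm) →
  (∀ x → Dom x → Σ[ b ∈ Bool ] (⟦ t ⟧ (order (graph x)) (encode x) ≡ encodeBool b × (T b ⇔ Yes x))) →
  PolyTimeDecidable encode Dom Yes
term-decides t correct with c , k , runs ← program-runs t = program t , c , k , λ x dom →
  let A = encodeGraph (graph x)
      S = encodeVec encodeBool (source x)
      U = encodeVec encodeBool (target x)
      b , computes , b⇔yes = correct x dom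
  in  b , subst (λ y → program t on encode x returns y within (c * size (encode x) ^ k + c))
            (trans (cong (λ n → ⟦ t ⟧ n (encode x)) (spine-encodeVec encodeBool (source x))) computes)
            (runs A S U)
        , b⇔yes

module _ (x : Instance) (K : CyclicOrder (graph x)) (v₀ : Fin (order (graph x))) where
  open Trail {graph x} {source x} {target x} K v₀
  private n = order (graph x)

  length-trail : length (trail n) ≡ n
  length-trail = trans (length-map (entryAt ∘ at) (downFrom n)) (length-downFrom n)

  decide⇔yes : T (decide n (trail n)) ⇔ YesInstance x
  decide⇔yes = mk⇔ (reach⇒yes x ∘ Equivalence.from reach ∘ Equivalence.to decide-correct)
                   (Equivalence.from decide-correct ∘ Equivalence.to reach ∘ yes⇒reach x)
    where reach = reach⇔ K {source x} {target x} (sourceIndep x) (targetIndep x)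

  decideᵗ-trail : ⟦ decideᵗ ⟧ n (encodeEntries (trail n)) ≡ encodeBool (decide n (trail n))
  -- The list terms are correct when the loop count is the length of the list, which for a full
  -- trail is `n`.
  decideᵗ-trail = subst (λ m → ⟦ decideᵗ ⟧ m (encodeEntries (trail n)) ≡ encodeBool (decide m (trail n)))
                    length-trail (decideᵗ-correct (trail n))

theorem3 : PolyTimeDecidable encode (λ x → IsOrientedCycle (graph x)) YesInstance
theorem3 = term-decides (walkᵗ ⟫ decideᵗ) λ x cyc →
  let K , v₀ , walked = walk-correct x (cyclicOrder (graph x) cyc)
      n = order (graph x)
  in  decide n (Trail.trail {graph x} {source x} {target x} K v₀ n)
    , trans (cong (⟦ decideᵗ ⟧ n) walked) (decideᵗ-trail x K v₀)
    , decide⇔yes x K v₀
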